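{- Let $Q=T[H_1,\dots,H_t]$ be a strong semicomplete composition with $n$ vertices. Then the smallest strong spanning subdigraph of $Q$ has precisely $n+\epsilon(Q)$ arcs.
   Context: Digraphs are finite, without loops or parallel arcs (2-cycles are allowed); cycles are directed. A digraph is semicomplete if there is at least one arc between every pair of distinct vertices. Let $T$ be a digraph with vertices $u_1,\dots,u_t$ ($t\ge 2$) and let $H_1,\dots,H_t$ be pairwise disjoint nonempty digraphs. The composition $Q=T[H_1,\dots,H_t]$ is the digraph with vertex set $\bigcup_i V(H_i)$ and arc set $\bigcup_{i=1}^t A(H_i)\cup\{xy : x\in V(H_i),\ y\in V(H_p),\ u_iu_p\in A(T)\}$. It is a semicomplete composition if $T$ is semicomplete. A digraph is strong if for every ordered pair of vertices $(x,y)$ there is a directed path from $x$ to $y$. The smallest strong spanning subdigraph of a strong digraph $D$ is a strong spanning subdigraph of $D$ with the fewest arcs. For a digraph $D$ and an integer $k\ge 0$, $H_k(D)$ is the digraph obtained from $D$ by adding $2k$ new vertices $x_1,\dots,x_k,y_1,\dots,y_k$, all arcs from every vertex of $D$ to each $x_i$, all arcs from each $y_i$ to every vertex of $D$, and all arcs $x_iy_j$, $i,j\in\{1,\dots,k\}$ (so $H_0(D)=D$). For a strong digraph $D$, $\epsilon(D)$ is the smallest $k\ge 0$ such that $H_k(D)$ is Hamiltonian, i.e., has a cycle containing all its vertices. -}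

module Defs where

open import Data.Fin.Base using (Fin)
import Data.Fin.Properties as Fin
open import Data.List.Base using (List; []; _∷_; _++_; _∷ʳ_; map; lookup; concat; length; filter; allFin; cartesianProduct)
open import Data.List.Membership.Propositional using (_∈_)
open import Data.List.Membership.Propositional.Properties using (∈-map⁺; ∈-map⁻; ∈-++⁺ˡ; ∈-++⁺ʳ; ∈-++⁻; ∈-concat⁺′; ∈-allFin)
open import Data.List.Relation.Binary.Disjoint.Propositional using (Disjoint)
import Data.List.Relation.Unary.All as All
import Data.List.Relation.Unary.All.Properties as All
import Data.List.Relation.Unary.AllPairs as AllPairs
import Data.List.Relation.Unary.AllPairs.Properties as AllPairs
import Data.List.Relation.Unary.Any as Any
import Data.List.Relation.Unary.Any.Properties as Any
open import Data.List.Relation.Unary.Linked using (Linked)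
open import Data.List.Relation.Unary.Unique.Propositional using (Unique)
import Data.List.Relation.Unary.Unique.Propositional.Properties as Unique
open import Data.Nat.Base using (ℕ; _≤_)
open import Data.Product.Base using (Σ; ∃; _×_; _,_; uncurry)
open import Data.Sum.Base using (_⊎_; inj₁; inj₂)
open import Function.Base using (_∘_)
open import Level using (0ℓ)
open import Relation.Binary.Core using (Rel; _⇒_)
open import Relation.Binary.Definitions using (Decidable; DecidableEquality)
open import Relation.Binary.Construct.Closure.ReflexiveTransitive using (Star; ε; _◅_)
open import Relation.Binary.PropositionalEquality using (_≡_; _≢_; refl; sym; trans; cong)
open import Relation.Nullary using (¬_; yes; no)

-- Arcs form a relation, so there are no parallel arcs; decidability makes
-- the arc set a finite set that can be counted.
record Digraph : Set₁ where
  field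
    Vertex   : Set
    vertices : List Vertex
    distinct : Unique vertices
    complete : ∀ v → v ∈ vertices
    Arc      : Rel Vertex 0ℓ
    arc?     : Decidable Arc
    loopless : ∀ {v} → ¬ Arc v v

  order : ℕ
  order = length vertices

  size : ℕ
  size = length (filter (uncurry arc?) (cartesianProduct vertices vertices))

  _≟_ : DecidableEquality Vertex
  x ≟ y with Any.index (complete x) Fin.≟ Any.index (complete y)
  ... | yes eq = yes (trans (Any.lookup-index (complete x))
                     (trans (cong (lookup vertices) eq)
                            (sym (Any.lookup-index (complete y)))))
  ... | no neq = no (neq ∘ cong (Any.index ∘ complete))

open Digraph public using (Vertex; order; size)

-- A walk is an element of Star Arc; a path is a walk without repeated vertices.
visited : ∀ {V : Set} {R : Rel V 0ℓ} {x y} → Star R x y → List V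
visited {x = x} ε       = x ∷ []
visited {x = x} (_ ◅ w) = x ∷ visited w

Path : (D : Digraph) → Rel (Vertex D) 0ℓ
Path D x y = Σ (Star (Digraph.Arc D) x y) (Unique ∘ visited)

Strong : Digraph → Set
Strong D = ∀ x y → Path D x y

Semicomplete : Digraph → Set
Semicomplete D = ∀ x y → x ≢ y → Arc x y ⊎ Arc y x
  where open Digraph D

-- The cycle v₁ v₂ … vₘ v₁ is given by v₁ and the list v₂ … vₘ.  The case
-- m = 1 would need a loop, so every cycle has length at least two.
IsCycle : (D : Digraph) → Vertex D → List (Vertex D) → Set
IsCycle D v vs = Unique (v ∷ vs) × Linked (Digraph.Arc D) (v ∷ (vs ∷ʳ v))

Hamiltonian : Digraph → Set
Hamiltonian D = ∃ λ v → ∃ λ vs → IsCycle D v vs × (∀ u → u ∈ v ∷ vs)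

-- The composition T[H₁,…,Hₜ], with the family H indexed by the vertices of T.
-- Tagging by the vertex of T makes the vertex sets of the Hᵢ disjoint.
module _ (T : Digraph) (H : Vertex T → Digraph) where

  private
    module T = Digraph T
    module H (i : Vertex T) = Digraph (H i)

  CompVertex : Set
  CompVertex = Σ (Vertex T) λ i → Vertex (H i)

  data CompArc : Rel CompVertex 0ℓ where
    inner : ∀ {i x y} → H.Arc i x y → CompArc (i , x) (i , y)
    outer : ∀ {i p x y} → T.Arc i p → CompArc (i , x) (p , y)

  private
    fibre : Vertex T → List CompVertex
    fibre i = map (i ,_) (H.vertices i)

    fibres-disjoint : ∀ {i p} → i ≢ p → Disjoint (fibre i) (fibre p)
    fibres-disjoint i≢p (v∈ , v∈′) with ∈-map⁻ _ v∈ | ∈-map⁻ _ v∈′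
    ... | _ , _ , refl | _ , _ , refl = i≢p refl

    ,-injective : ∀ {i} {x y : Vertex (H i)} → _≡_ {A = CompVertex} (i , x) (i , y) → x ≡ y
    ,-injective refl = refl

    compArc? : Decidable CompArc
    compArc? (i , x) (p , y) with T.arc? i p
    ... | yes a = yes (outer a)
    ... | no ¬a with i T.≟ p
    ...   | no i≢p = no λ { (inner _) → i≢p refl ; (outer a) → ¬a a }
    ...   | yes refl with H.arc? i x y
    ...     | yes b = yes (inner b)
    ...     | no ¬b = no λ { (inner b) → ¬b b ; (outer a) → ¬a a }

    compLoopless : ∀ {v} → ¬ CompArc v v
    compLoopless (inner a) = H.loopless _ a
    compLoopless (outer a) = T.loopless a

  composition : Digraph
  composition = record
    { Vertex   = CompVertex
    ; vertices = concat (map fibre T.vertices)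
    ; distinct = Unique.concat⁺
        (All.map⁺ (All.universal (λ i → Unique.map⁺ ,-injective (H.distinct i)) T.vertices))
        (AllPairs.map⁺ (AllPairs.map fibres-disjoint T.distinct))
    ; complete = λ (i , x) → ∈-concat⁺′ (∈-map⁺ (i ,_) (H.complete i x)) (∈-map⁺ fibre (T.complete i))
    ; Arc      = CompArc
    ; arc?     = compArc?
    ; loopless = compLoopless
    }

record SpanningSubdigraph (D : Digraph) : Set₁ where
  private module D = Digraph D
  field
    SubArc  : Rel (Vertex D) 0ℓ
    subArc? : Decidable SubArc
    sub     : SubArc ⇒ D.Arc

  digraph : Digraph
  digraph = record
    { Vertex   = D.Vertex
    ; vertices = D.vertices
    ; distinct = D.distinct
    ; complete = D.complete
    ; Arc      = SubArc
    ; arc?     = subArc?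
    ; loopless = D.loopless ∘ sub
    }

open SpanningSubdigraph public using (digraph)

IsSmallestStrongSpanning : (D : Digraph) → SpanningSubdigraph D → Set₁
IsSmallestStrongSpanning D S =
  Strong (digraph S) ×
  (∀ (S′ : SpanningSubdigraph D) → Strong (digraph S′) → size (digraph S) ≤ size (digraph S′))

module _ (k : ℕ) (D : Digraph) where

  private module D = Digraph D

  data ExtVertex : Set where
    old : Vertex D → ExtVertex
    x y : Fin k → ExtVertex

  data ExtArc : Rel ExtVertex 0ℓ where
    old-old : ∀ {u v} → D.Arc u v → ExtArc (old u) (old v)
    old-x   : ∀ {u i} → ExtArc (old u) (x i)
    y-old   : ∀ {i u} → ExtArc (y i) (old u)
    x-y     : ∀ {i j} → ExtArc (x i) (y j)

  private
    extVertices : List ExtVertex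
    extVertices = map old D.vertices ++ map x (allFin k) ++ map y (allFin k)

    x-disjoint-y : Disjoint (map x (allFin k)) (map y (allFin k))
    x-disjoint-y (v∈ , v∈′) with ∈-map⁻ x v∈ | ∈-map⁻ y v∈′
    ... | _ , _ , refl | _ , _ , ()

    old-disjoint-xy : Disjoint (map old D.vertices) (map x (allFin k) ++ map y (allFin k))
    old-disjoint-xy (v∈ , v∈′) with ∈-map⁻ old v∈ | ∈-++⁻ (map x (allFin k)) v∈′
    ... | _ , _ , refl | inj₁ v∈x with ∈-map⁻ x v∈x
    ...   | _ , _ , ()
    old-disjoint-xy (v∈ , v∈′) | _ , _ , refl | inj₂ v∈y with ∈-map⁻ y v∈y
    ...   | _ , _ , ()

    extDistinct : Unique extVertices
    extDistinct =
      Unique.++⁺ (Unique.map⁺ (λ { refl → refl }) D.distinct)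
        (Unique.++⁺ (Unique.map⁺ (λ { refl → refl }) (Unique.allFin⁺ k))
                    (Unique.map⁺ (λ { refl → refl }) (Unique.allFin⁺ k)) x-disjoint-y)
        old-disjoint-xy

    extComplete : ∀ v → v ∈ extVertices
    extComplete (old u) = ∈-++⁺ˡ (∈-map⁺ old (D.complete u))
    extComplete (x i)   = ∈-++⁺ʳ (map old D.vertices) (∈-++⁺ˡ (∈-map⁺ x (∈-allFin i)))
    extComplete (y i)   = ∈-++⁺ʳ (map old D.vertices) (∈-++⁺ʳ (map x (allFin k)) (∈-map⁺ y (∈-allFin i)))

    extArc? : Decidable ExtArc
    extArc? (old u) (old v) with D.arc? u v
    ... | yes a = yes (old-old a)
    ... | no ¬a = no λ { (old-old a) → ¬a a }
    extArc? (old _) (x _)   = yes old-x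
    extArc? (old _) (y _)   = no λ ()
    extArc? (x _)   (old _) = no λ ()
    extArc? (x _)   (x _)   = no λ ()
    extArc? (x _)   (y _)   = yes x-y
    extArc? (y _)   (old _) = yes y-old
    extArc? (y _)   (x _)   = no λ ()
    extArc? (y _)   (y _)   = no λ ()

    extLoopless : ∀ {v} → ¬ ExtArc v v
    extLoopless (old-old a) = D.loopless a

  -- The digraph H_k(D).
  extension : Digraph
  extension = record
    { Vertex   = ExtVertex
    ; vertices = extVertices
    ; distinct = extDistinct
    ; complete = extComplete
    ; Arc      = ExtArc
    ; arc?     = extArc?
    ; loopless = extLoopless
    }

-- IsEpsilon D k says ε(D) = k; at most one k satisfies it.
IsEpsilon : Digraph → ℕ → Set
IsEpsilon D k = Hamiltonian (extension k D) × (∀ j → Hamiltonian (extension j D) → k ≤ j)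

{-# OPTIONS --safe #-}
-- For k ≥ 1, H_k(D) is Hamiltonian iff D can be covered by k disjoint paths.
--
-- A strong digraph with n + j arcs arises from a cycle by adding j ears. The
-- cycle together with the first ear is covered by one path, and every further
-- ear by one more, so n + ε(Q) arcs are necessary.
--
-- Conversely let Q be covered by k paths and contract the runs of these paths
-- inside the H_i to single items, so that non-adjacent items are twins. Split
-- the paths into cycles and at most k transitive paths, which remain paths when
-- vertices are removed. A cycle C missing some part can be enlarged by items of
-- the transitive paths or by merging it with another cycle: if every other
-- cycle and every missed part is joined to C in one direction only, then a walk
-- in T between C and a missed part yields a detour that can be inserted into C.
-- Once C meets every part, each remaining path has an in-neighbour of its first
-- and an out-neighbour of its last vertex on C, hence is an ear of C, and C with
-- these at most k ears has at most n + k arcs.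
module Submission where

open import Defs hiding (x; y)
import Algebra.Solver.CommutativeMonoid
open import Data.Empty using (⊥; ⊥-elim)
open import Data.Fin.Base using (Fin; zero; suc)
open import Data.List.Base using (List; []; _∷_; _++_; _∷ʳ_; _ʳ++_; [_]; length; map; mapMaybe; concat; concatMap; tabulate; allFin; cartesianProduct; cartesianProductWith)
import Data.List.Membership.DecPropositional as DecMembership
open import Data.List.Membership.Propositional using (_∈_; _∉_; find; lose)
open import Data.List.Membership.Propositional.Properties using (∈-∃++; ∈-++⁺ˡ; ∈-++⁺ʳ; ∈-++⁻; ∈-map⁻; ∈-filter⁺; ∈-filter⁻; ∈-concatMap⁺; ∈-concatMap⁻; ∈-cartesianProduct⁺; ∈-cartesianProductWith⁺)
open import Data.List.Properties using (length-++; ++-assoc; ++-identityʳ; map-++; concat-++; concatMap-++; length-tabulate; ʳ++-defn)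
open import Data.List.Relation.Binary.Permutation.Propositional using (_↭_; prep; swap; ↭-refl; ↭-sym; ↭-trans; ↭-reflexive)
open import Data.List.Relation.Binary.Permutation.Propositional.Properties using (∈-resp-↭; All-resp-↭; ↭-length; ↭-reverse; shift; shifts; map⁺; mapMaybe-↭; ++⁺; ++⁺ˡ; ++⁺ʳ; ++-comm; ++-commutativeMonoid; drop-∷)
open import Data.List.Relation.Unary.All as All using (All; []; _∷_)
import Data.List.Relation.Unary.All.Properties as All
open import Data.List.Relation.Unary.AllPairs using (AllPairs; []; _∷_)
open import Data.List.Relation.Unary.Any as Any using (Any; here; there)
open import Data.List.Relation.Unary.Linked as Linked using (Linked; []; [-]; _∷_)
import Data.List.Relation.Unary.Linked.Properties as Linked
open import Data.List.Relation.Unary.Unique.DecPropositional using (unique?)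
open import Data.List.Relation.Unary.Unique.Propositional using (Unique)
import Data.List.Relation.Unary.Unique.Propositional.Properties as Unique
open import Data.Maybe.Base using (Maybe; just; nothing)
open import Data.Nat.Base using (ℕ; zero; suc; _+_; _≤_; _<_; z≤n; s≤s)
import Data.Nat.Properties as ℕ
open import Data.Product.Base using (Σ; ∃; ∃₂; _×_; _,_; proj₁; proj₂; uncurry)
import Data.Product.Properties as Product
open import Data.Sum.Base using (_⊎_; inj₁; inj₂)
open import Function.Base using (_∘_; id; flip)
open import Level using (0ℓ)
open import Relation.Binary.Construct.Closure.ReflexiveTransitive using (Star; ε; _◅_; _◅◅_)
open import Relation.Binary.Core using (Rel; _⇒_)
import Relation.Binary.Definitions as Binary
open import Relation.Binary.PropositionalEquality using (_≡_; _≢_; refl; sym; trans; cong; cong₂; subst; module ≡-Reasoning)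
open import Relation.Nullary using (¬_; Dec; yes; no)
open import Relation.Nullary.Decidable using (¬?; map′; _×-dec_; decidable-stable)
open import Relation.Unary using (Pred; Decidable)

-- Walks and cycles

module Perm {A : Set} = Algebra.Solver.CommutativeMonoid (++-commutativeMonoid {A = A})
open Perm using (solve; _⊜_; _⊕_)

module _ {A : Set} where

  private variable
    v : A
    ws xs ys : List A

  ∈⇒↭ : v ∈ xs → ∃ λ ys → v ∷ ys ↭ xs
  ∈⇒↭ v∈xs with ∈-∃++ v∈xs
  ... | as , bs , refl = as ++ bs , ↭-sym (shift _ as bs)

  unique-⊆⇒↭ : Unique ws → (∀ {v} → v ∈ ws → v ∈ xs) → ∃ λ zs → ws ++ zs ↭ xs
  unique-⊆⇒↭ {ws = []} {xs} _ _ = xs , ↭-refl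
  unique-⊆⇒↭ {ws = w ∷ ws} (w∉ ∷ u) ws⊆ with ∈⇒↭ (ws⊆ (here refl))
  ... | ys , ys↭ with unique-⊆⇒↭ u ws⊆ys
    where
    ws⊆ys : ∀ {v} → v ∈ ws → v ∈ ys
    ws⊆ys v∈ with ∈-resp-↭ (↭-sym ys↭) (ws⊆ (there v∈))
    ... | here refl = ⊥-elim (All.lookup w∉ v∈ refl)
    ... | there v∈ys = v∈ys
  ... | zs , zs↭ = zs , ↭-trans (prep w zs↭) ys↭

  unique-⊆⇒length≤ : Unique ws → (∀ {v} → v ∈ ws → v ∈ xs) → length ws ≤ length xs
  unique-⊆⇒length≤ {ws} {xs} u ws⊆ with unique-⊆⇒↭ u ws⊆
  ... | zs , zs↭ = subst (length ws ≤_) (trans (sym (length-++ ws)) (↭-length zs↭)) (ℕ.m≤m+n _ _)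

  unique-++ˡ : ∀ xs → Unique (xs ++ ys) → Unique xs
  unique-++ˡ [] _ = []
  unique-++ˡ (x ∷ xs) (x∉ ∷ u) = All.++⁻ˡ xs x∉ ∷ unique-++ˡ xs u

  unique-++⇒disjoint : ∀ xs → Unique (xs ++ ys) → v ∈ xs → v ∉ ys
  unique-++⇒disjoint (x ∷ xs) (x∉ ∷ u) (here refl) v∈ys = All.lookup x∉ (∈-++⁺ʳ xs v∈ys) refl
  unique-++⇒disjoint (x ∷ xs) (_ ∷ u) (there v∈xs) v∈ys = unique-++⇒disjoint xs u v∈xs v∈ys

  unique-resp-↭ : xs ↭ ys → Unique xs → Unique ys
  unique-resp-↭ _↭_.refl u = u
  unique-resp-↭ (prep x p) (x∉ ∷ u) = All-resp-↭ p x∉ ∷ unique-resp-↭ p u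
  unique-resp-↭ (swap x y p) ((x≢y ∷ x∉) ∷ y∉ ∷ u) =
    (x≢y ∘ sym ∷ All-resp-↭ p y∉) ∷ All-resp-↭ p x∉ ∷ unique-resp-↭ p u
  unique-resp-↭ (_↭_.trans p q) = unique-resp-↭ q ∘ unique-resp-↭ p

  unique-⊆⊇⇒↭ : Unique xs → Unique ys → (∀ {v} → v ∈ xs → v ∈ ys) → (∀ {v} → v ∈ ys → v ∈ xs) → xs ↭ ys
  unique-⊆⊇⇒↭ {xs} uxs uys xs⊆ys ys⊆xs with unique-⊆⇒↭ uxs xs⊆ys
  ... | [] , p = ↭-trans (↭-sym (↭-reflexive (++-identityʳ xs))) p
  ... | z ∷ zs , p = ⊥-elim (unique-++⇒disjoint xs (unique-resp-↭ (↭-sym p) uys)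
                       (ys⊆xs (∈-resp-↭ p (∈-++⁺ʳ xs (here refl)))) (here refl))

module _ {A : Set} (R : Rel A 0ℓ) where

  -- The list records the vertices of the walk except the last one, so that
  -- for a closed walk it lists every visit exactly once.
  data Walk : A → A → List A → Set where
    []  : ∀ {a} → Walk a a []
    _∷_ : ∀ {a b c xs} → R a b → Walk b c xs → Walk a c (a ∷ xs)

  -- Cycles are taken up to the order in which their vertices are listed.
  Cycle : List A → Set
  Cycle zs = ∃₂ λ l f → ∃ λ xs → R l f × Walk f l xs × l ∷ xs ↭ zs

module _ {A : Set} {R : Rel A 0ℓ} where

  private variable
    a b c d f l v : A
    xs ys zs : List A

  infixr 5 _++ʷ_

  _++ʷ_ : Walk R a b xs → Walk R b c ys → Walk R a c (xs ++ ys)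
  [] ++ʷ w′ = w′
  (r ∷ w) ++ʷ w′ = r ∷ (w ++ʷ w′)

  splitʷ : Walk R a b zs → v ∈ zs →
    ∃ λ c → ∃₂ λ xs ys → Walk R a v xs × R v c × Walk R c b ys × zs ≡ xs ++ v ∷ ys
  splitʷ (r ∷ w) (here refl) = _ , _ , _ , [] , r , w , refl
  splitʷ (r ∷ w) (there v∈) with splitʷ w v∈
  ... | _ , _ , _ , w₁ , s , w₂ , refl = _ , _ , _ , r ∷ w₁ , s , w₂ , refl

  unsnocʷ : R a b → Walk R b c xs → ∃₂ λ d ys → Walk R a d ys × R d c × a ∷ xs ≡ ys ∷ʳ d
  unsnocʷ r [] = _ , _ , [] , r , refl
  unsnocʷ r (s ∷ w) with unsnocʷ s w
  ... | _ , _ , w′ , t , eq = _ , _ , r ∷ w′ , t , cong (_ ∷_) eq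

  cycle-from : v ∈ zs → Cycle R zs → ∃₂ λ f xs → R v f × Walk R f v xs × v ∷ xs ↭ zs
  cycle-from v∈ (l , f , xs , r , w , p) with ∈-resp-↭ (↭-sym p) v∈
  ... | here refl = f , xs , r , w , p
  ... | there v∈xs with splitʷ w v∈xs
  ...   | c , as , bs , w₁ , s , w₂ , refl = c , bs ++ l ∷ as , s , w₂ ++ʷ (r ∷ w₁) ,
          ↭-trans (solve 4 (λ v bs l as → v ⊕ bs ⊕ l ⊕ as ⊜ l ⊕ as ⊕ v ⊕ bs) ↭-refl [ _ ] bs [ l ] as) p

  cycle-to : v ∈ zs → Cycle R zs → ∃₂ λ l xs → R l v × Walk R v l xs × l ∷ xs ↭ zs
  cycle-to v∈ cyc with cycle-from v∈ cyc
  ... | f , xs , r , w , p with unsnocʷ r w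
  ...   | l , ys , w′ , s , eq = l , ys , s , w′ ,
          ↭-trans (↭-trans (↭-sym (++-comm ys [ l ])) (↭-reflexive (sym eq))) p

  cycle-insert : Walk R d c xs → R c f → Walk R f l ys → R l d → Cycle R (l ∷ ys ++ c ∷ xs)
  cycle-insert {c = c} {xs = xs} {l = l} {ys = ys} w r w′ s = _ , _ , ys ++ l ∷ xs , r , w′ ++ʷ (s ∷ w) ,
    solve 4 (λ c ys l xs → c ⊕ ys ⊕ l ⊕ xs ⊜ l ⊕ ys ⊕ c ⊕ xs) ↭-refl [ c ] ys [ l ] xs

  cycle-resp-↭ : xs ↭ ys → Cycle R xs → Cycle R ys
  cycle-resp-↭ p (l , f , xs , r , w , q) = l , f , xs , r , w , ↭-trans q p

  closedWalk⇒cycle : Walk R a a (v ∷ xs) → Cycle R (v ∷ xs)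
  closedWalk⇒cycle (r ∷ w) = _ , _ , _ , r , w , ↭-refl

  crossing : {P : Pred A 0ℓ} → Decidable P → Walk R a b xs → ¬ P a → Any P (xs ∷ʳ b) →
    ∃₂ λ e f → ∃₂ λ ys zs →
      Walk R a e ys × R e f × Walk R f b zs × ¬ P e × P f × xs ≡ ys ++ e ∷ zs
  crossing P? [] ¬Pa (here Pa) = ⊥-elim (¬Pa Pa)
  crossing P? (r ∷ w) ¬Pa (here Pa) = ⊥-elim (¬Pa Pa)
  crossing P? (_∷_ {b = b} r w) ¬Pa (there any) with P? b
  ... | yes Pb = _ , _ , _ , _ , [] , r , w , ¬Pa , Pb , refl
  ... | no ¬Pb with crossing P? w ¬Pb any
  ...   | e , f , ys , zs , w₁ , s , w₂ , ¬Pe , Pf , refl =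
          e , f , _ ∷ ys , zs , r ∷ w₁ , s , w₂ , ¬Pe , Pf , refl

  crossing★ : {P : Pred A 0ℓ} → Decidable P → Star R a b → ¬ P a → P b →
    ∃₂ λ e f → R e f × ¬ P e × P f
  crossing★ P? ε ¬Pa Pa = ⊥-elim (¬Pa Pa)
  crossing★ P? (_◅_ {j = b} r w) ¬Pa Pz with P? b
  ... | yes Pb = _ , _ , r , ¬Pa , Pb
  ... | no ¬Pb = crossing★ P? w ¬Pb Pz

  arcs : Walk R a b xs → List (A × A)
  arcs [] = []
  arcs (_∷_ {a} {b} _ w) = (a , b) ∷ arcs w

  length-arcs : (w : Walk R a b xs) → length (arcs w) ≡ length xs
  length-arcs [] = refl
  length-arcs (_ ∷ w) = cong suc (length-arcs w)

  arcs-++ : (w : Walk R a b xs) (w′ : Walk R b c ys) → arcs (w ++ʷ w′) ≡ arcs w ++ arcs w′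
  arcs-++ [] w′ = refl
  arcs-++ (r ∷ w) w′ = cong (_ ∷_) (arcs-++ w w′)

  arcs⊆ : (w : Walk R a b xs) → (c , d) ∈ arcs w → R c d
  arcs⊆ (r ∷ w) (here refl) = r
  arcs⊆ (r ∷ w) (there e∈) = arcs⊆ w e∈

  arc-source : (w : Walk R a b xs) → (c , d) ∈ arcs w → c ∈ xs
  arc-source (r ∷ w) (here refl) = here refl
  arc-source (r ∷ w) (there e∈) = there (arc-source w e∈)

  arc-target : (w : Walk R a b xs) → (c , d) ∈ arcs w → d ∈ xs ∷ʳ b
  arc-target (r ∷ []) (here refl) = there (here refl)
  arc-target (r ∷ (_ ∷ _)) (here refl) = there (here refl)
  arc-target (r ∷ w) (there e∈) = there (arc-target w e∈)

  unique-arcs : (w : Walk R a b xs) → Unique xs → Unique (arcs w)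
  unique-arcs [] _ = []
  unique-arcs (r ∷ w) (a∉ ∷ u) =
    All.tabulate (λ e∈ → λ { refl → All.lookup a∉ (arc-source w e∈) refl }) ∷ unique-arcs w u

  linked⇒walk : Linked R (a ∷ (xs ∷ʳ b)) → Walk R a b (a ∷ xs)
  linked⇒walk {xs = []} (r ∷ [-]) = r ∷ []
  linked⇒walk {xs = _ ∷ _} (r ∷ rs) = r ∷ linked⇒walk rs

  walk⇒linked : Walk R a b xs → Linked R (xs ∷ʳ b)
  walk⇒linked [] = [-]
  walk⇒linked (r ∷ []) = r ∷ [-]
  walk⇒linked (r ∷ (s ∷ w)) = r ∷ walk⇒linked (s ∷ w)

  linked⇒walk-to : Linked R (a ∷ xs ++ b ∷ ys) → Walk R a b (a ∷ xs) × Linked R (b ∷ ys)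
  linked⇒walk-to {xs = []} (r ∷ rs) = r ∷ [] , rs
  linked⇒walk-to {xs = _ ∷ _} (r ∷ rs) with linked⇒walk-to rs
  ... | w , rs′ = r ∷ w , rs′

  star-to : Walk R a b xs → v ∈ xs ∷ʳ b → Star R a v
  star-to [] (here refl) = ε
  star-to (r ∷ w) (here refl) = ε
  star-to (r ∷ w) (there v∈) = r ◅ star-to w v∈

  star-from : Walk R a b xs → v ∈ xs → Star R v b
  star-from (r ∷ w) (here refl) = r ◅ star-from′ w
    where
    star-from′ : Walk R a b xs → Star R a b
    star-from′ [] = ε
    star-from′ (r ∷ w) = r ◅ star-from′ w
  star-from (r ∷ w) (there v∈) = star-from w v∈

  mapʷ : {S : Rel A 0ℓ} (w : Walk R a b xs) → (∀ {c d} → (c , d) ∈ arcs w → S c d) → Walk S a b xs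
  mapʷ [] _ = []
  mapʷ (r ∷ w) f = f (here refl) ∷ mapʷ w (f ∘ there)

  -- Only the replaced arc may disappear from `w`. This is recorded because the gaps of other
  -- vertices must survive when several segments are inserted one after another.
  insert-at-arc : (w : Walk R a b zs) → (c , d) ∈ arcs w → Walk R c d (c ∷ xs) →
    ∃₂ λ zs′ (w′ : Walk R a b zs′) → zs′ ↭ xs ++ zs ×
      (∀ {e} → e ∈ arcs w → e ≡ (c , d) ⊎ e ∈ arcs w′)
  insert-at-arc {zs = c ∷ zs} {xs = xs} (r ∷ w) (here refl) w₀ = _ , w₀ ++ʷ w , ↭-sym (shift c xs zs) , keep
    where
    keep : ∀ {e} → e ∈ arcs (r ∷ w) → e ≡ _ ⊎ e ∈ arcs (w₀ ++ʷ w)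
    keep (here refl) = inj₁ refl
    keep (there e∈) = inj₂ (subst (_ ∈_) (sym (arcs-++ w₀ w)) (∈-++⁺ʳ (arcs w₀) e∈))
  insert-at-arc {zs = a ∷ zs} {xs = xs} (r ∷ w) (there e∈) w₀ with insert-at-arc w e∈ w₀
  ... | zs′ , w′ , p , keep = _ , r ∷ w′ , ↭-trans (prep a p) (↭-sym (shift a xs zs)) , keep′
    where
    keep′ : ∀ {e} → e ∈ arcs (r ∷ w) → e ≡ _ ⊎ e ∈ arcs (r ∷ w′)
    keep′ (here refl) = inj₂ (here refl)
    keep′ (there e∈) with keep e∈
    ... | inj₁ eq = inj₁ eq
    ... | inj₂ e∈′ = inj₂ (there e∈′)

  -- The list `xs` leaves out the end `l`, so `l` in `P` is a case of its own. In the remaining case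
  -- with a vertex in `P`, the cut comes right after the last such vertex.
  last-split : {P : Pred A 0ℓ} → Decidable P → Walk R f l xs →
    All (¬_ ∘ P) (xs ∷ʳ l) ⊎
    (P l ⊎ ∃₂ λ d g → ∃₂ λ ys zs →
      Walk R f d ys × P d × R d g × Walk R g l zs × All (¬_ ∘ P) (zs ∷ʳ l) × xs ≡ ys ++ d ∷ zs)
  last-split {l = l} P? [] with P? l
  ... | yes Pl = inj₂ (inj₁ Pl)
  ... | no ¬Pl = inj₁ (¬Pl ∷ [])
  last-split {f = f} P? (r ∷ w) with last-split P? w
  ... | inj₂ (inj₁ Pl) = inj₂ (inj₁ Pl)
  ... | inj₂ (inj₂ (d , g , ys , zs , w₁ , Pd , s , w₂ , ¬P , refl)) =
        inj₂ (inj₂ (d , g , f ∷ ys , zs , r ∷ w₁ , Pd , s , w₂ , ¬P , refl))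
  ... | inj₁ ¬P with P? f
  ...   | yes Pf = inj₂ (inj₂ (f , _ , [] , _ , [] , Pf , r , w , ¬P , refl))
  ...   | no ¬Pf = inj₁ (¬Pf ∷ ¬P)

module _ {A : Set} {R : Rel A 0ℓ} (R? : Binary.Decidable R) where

  Gap : {a b : A} {xs : List A} → Walk R a b xs → A → Set
  Gap w d = ∃₂ λ c c′ → (c , c′) ∈ arcs w × R c d × R d c′

  -- The longest initial segment that fits into a gap of the first vertex is
  -- inserted there; no later vertex uses that gap, so their gaps survive.
  multi-insert : ∀ {a f l xs zs} n → length xs < n → (w : Walk R a a zs) → Walk R f l xs → All (Gap w) (xs ∷ʳ l) →
    ∃ λ zs′ → Walk R a a zs′ × zs′ ↭ (l ∷ xs) ++ zs
  multi-insert {a} {f} {l} {xs} {zs} (suc n) (s≤s lt) w block gaps = main (head-gap block gaps)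
    where
    head-gap : ∀ {f} {xs} → Walk R f l xs → All (Gap w) (xs ∷ʳ l) → Gap w f
    head-gap [] (g ∷ []) = g
    head-gap (_ ∷ _) (g ∷ _) = g

    main : Gap w f → ∃ λ zs′ → Walk R a a zs′ × zs′ ↭ (l ∷ xs) ++ zs
    -- A segment of the block that starts at `f` fits between `c` and `c′` as soon as its last
    -- vertex has an arc to `c′`.
    main (c , c′ , e∈ , r , s) with last-split (λ d → R? d c′) block
    ... | inj₁ ¬P = ⊥-elim (last-contra block ¬P)
      where
      last-contra : ∀ {xs} → Walk R f l xs → ¬ All (¬_ ∘ λ d → R d c′) (xs ∷ʳ l)
      last-contra [] (¬s ∷ []) = ¬s s
      last-contra (_ ∷ _) (¬s ∷ _) = ¬s s
    ... | inj₂ (inj₁ s′) with insert-at-arc w e∈ (r ∷ (block ++ʷ (s′ ∷ [])))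
    ...   | zs′ , w′ , p , _ = zs′ , w′ , ↭-trans p (++⁺ʳ zs (++-comm xs [ l ]))
    main (c , c′ , e∈ , r , s)
      | inj₂ (inj₂ (d , g , ys , us , w₁ , s′ , t , w₂ , ¬P , refl))
      with insert-at-arc w e∈ (r ∷ (w₁ ++ʷ (s′ ∷ [])))
    ... | zs′ , w′ , p , keep with multi-insert n lt′ w′ w₂ gaps′
      where
      lt′ : length us < n
      lt′ = ℕ.≤-trans (ℕ.≤-trans (ℕ.m≤n+m _ (length ys)) (ℕ.≤-reflexive (sym (length-++ ys)))) lt
      gap′ : ∀ {v} → ¬ R v c′ → Gap w v → Gap w′ v
      gap′ ¬s (x , y , xy∈ , q , q′) with keep xy∈
      ... | inj₁ refl = ⊥-elim (¬s q′)
      ... | inj₂ xy∈′ = x , y , xy∈′ , q , q′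
      gaps′ : All (Gap w′) (us ∷ʳ l)
      gaps′ = All.zipWith (λ (¬s , g) → gap′ ¬s g)
        (¬P , All.++⁻ʳ (ys ++ [ d ]) (subst (All (Gap w)) (trans (++-assoc ys (d ∷ us) [ l ]) (sym (++-assoc ys [ d ] _))) gaps))
    ...   | zs″ , w″ , p′ = zs″ , w″ , ↭-trans p′ (↭-trans (++⁺ˡ (l ∷ us) p)
            (solve 5 (λ l us ys d zs → (l ⊕ us) ⊕ (ys ⊕ d) ⊕ zs ⊜ (l ⊕ ys ⊕ d ⊕ us) ⊕ zs)
              ↭-refl [ l ] us ys [ d ] zs))

-- Exchange arguments in a blow-up of a semicomplete digraph

-- The elements of `V` are the items and those of `I` the parts. Adjacency depends on labels only:
-- items with equal labels are non-adjacent twins, all other pairs are joined by an arc.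
module Exchange {I V : Set} {A : Rel I 0ℓ} (A? : Binary.Decidable A) (irr : ∀ {i} → ¬ A i i)
  (_≟_ : Binary.DecidableEquality I) (semicomplete : ∀ i j → i ≢ j → A i j ⊎ A j i)
  (lab : V → I) where

  R : Rel V 0ℓ
  R v w = A (lab v) (lab w)

  R? : Binary.Decidable R
  R? v w = A? (lab v) (lab w)

  compare : ∀ i j → A i j ⊎ A j i ⊎ i ≡ j
  compare i j with i ≟ j
  ... | yes i≡j = inj₂ (inj₂ i≡j)
  ... | no i≢j with semicomplete i j i≢j
  ...   | inj₁ a = inj₁ a
  ...   | inj₂ a = inj₂ (inj₁ a)

  private variable
    a b c d f l u v : V
    ds ks us ws xs ys zs : List V
    p q : I
    k : ℕ

  -- Twins have the same in-neighbours. The walk must have an arc, since the last one is redirected.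
  relabel-end : ∀ {x} → Walk R a b (x ∷ xs) → lab b ≡ lab c → Walk R a c (x ∷ xs)
  relabel-end (r ∷ []) eq = subst (A _) eq r ∷ []
  relabel-end (r ∷ w@(_ ∷ _)) eq = r ∷ relabel-end w eq

  relabel-head : lab u ≡ lab v → Linked (flip R) (u ∷ us) → Linked (flip R) (v ∷ us)
  relabel-head eq [-] = [-]
  relabel-head eq (r ∷ ls) = subst (A _) eq r ∷ ls

  -- A path split at an item is kept as two lists, the left one running backwards, so that a segment
  -- between them can grow at both ends by pattern matching.
  join : Linked (flip R) (u ∷ us) → Linked R (u ∷ ws) → Linked R (us ʳ++ (u ∷ ws))
  join [-] rs = rs
  join (r ∷ ls) rs = join ls (r ∷ rs)

  ʳ++-↭ : ∀ us → us ʳ++ xs ↭ us ++ xs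
  ʳ++-↭ {xs = xs} us = ↭-trans (↭-reflexive (ʳ++-defn us)) (++⁺ʳ xs (↭-reverse us))

  -- Splitting paths into cycles and transitive paths

  Extraction : List V → Set
  Extraction xs = ∃₂ λ ds ps → Cycle R ds × Linked R ps × ds ++ ps ↭ xs

  -- The closed segment a … b of the path us⁻¹ a … b ws is cut out if its
  -- neighbours on the path can be linked, and extended by them if not.
  cut-out : Linked (flip R) (a ∷ us) → Walk R a b ks → R b a → Linked R (b ∷ ws) →
    Extraction (us ++ (b ∷ ks) ++ ws)
  cut-out {us = []} _ w r rs = _ , _ , (_ , _ , _ , r , w , ↭-refl) , Linked.tail rs , ↭-refl
  cut-out {us = u ∷ us} {b = b} {ks = ks} {ws = []} ls w r _ =
    _ , _ , (_ , _ , _ , r , w , ↭-refl) , join (Linked.tail ls) [-] ,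
    ↭-trans (++⁺ˡ (b ∷ ks) (↭-trans (ʳ++-↭ us) (++-comm us [ u ])))
      (solve 3 (λ u us k → k ⊕ u ⊕ us ⊜ (u ⊕ us) ⊕ k ⊕ Perm.id) ↭-refl [ u ] us (b ∷ ks))
  cut-out {a = a} {us = u ∷ us} {b = b} {ks = ks} {ws = w′ ∷ ws} (l ∷ ls) w r (r′ ∷ rs)
    with compare (lab u) (lab w′)
  ... | inj₁ s = _ , _ , (_ , _ , _ , r , w , ↭-refl) , join ls (s ∷ rs) ,
        ↭-trans (++⁺ˡ (b ∷ ks) (ʳ++-↭ us))
          (solve 5 (λ u us k w′ ws → k ⊕ us ⊕ u ⊕ w′ ⊕ ws ⊜ (u ⊕ us) ⊕ k ⊕ w′ ⊕ ws) ↭-refl [ u ] us (b ∷ ks) [ w′ ] ws)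
  ... | inj₂ (inj₁ s) with cut-out ls (l ∷ (w ++ʷ (r′ ∷ []))) s rs
  ...   | ds , ps , cyc , path , p = ds , ps , cyc , path , ↭-trans p
          (solve 6 (λ u us ks b w′ ws → us ⊕ (w′ ⊕ u ⊕ ks ⊕ b) ⊕ ws ⊜ (u ⊕ us) ⊕ (b ⊕ ks) ⊕ w′ ⊕ ws)
            ↭-refl [ u ] us ks [ b ] [ w′ ] ws)
  -- The neighbours `u` and `w′` are twins: `b` has an arc to `w′`, hence to `u`, so `u` joins the
  -- cycle and `w′` takes its place on the path.
  cut-out {a = a} {us = u ∷ us} {b = b} {ks = ks} {ws = w′ ∷ ws} (l ∷ ls) w r (r′ ∷ rs)
      | inj₂ (inj₂ eq) = _ , _ , (_ , _ , _ , subst (A _) (sym eq) r′ , l ∷ w , ↭-refl) , join (relabel-head eq ls) rs ,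
        ↭-trans (++⁺ˡ (b ∷ u ∷ ks) (ʳ++-↭ us))
          (solve 6 (λ u us ks b w′ ws → (b ⊕ u ⊕ ks) ⊕ us ⊕ w′ ⊕ ws ⊜ (u ⊕ us) ⊕ (b ⊕ ks) ⊕ w′ ⊕ ws)
            ↭-refl [ u ] us ks [ b ] [ w′ ] ws)

  -- The item `v` advances along the path as long as it has arcs to all later items. If this fails,
  -- some later `y` has an arc to `v` or is a twin of `v`, and either way a cycle splits off.
  transitive-or-extract : Linked (flip R) (v ∷ us) → Linked R (v ∷ xs) →
    AllPairs R (v ∷ xs) ⊎ Extraction (us ++ v ∷ xs)
  transitive-or-extract {v} {us} {xs} ls rs with All.all? (R? v) xs
  transitive-or-extract {v} {us} {[]} ls rs | yes all = inj₁ (all ∷ [])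
  transitive-or-extract {v} {us} {x ∷ xs} ls (r ∷ rs) | yes all with transitive-or-extract (r ∷ ls) rs
  ... | inj₁ ap = inj₁ (all ∷ ap)
  ... | inj₂ (ds , ps , cyc , path , p) = inj₂ (ds , ps , cyc , path , ↭-trans p (↭-sym (shift v us (x ∷ xs))))
  transitive-or-extract {v} {us} {xs} ls rs | no ¬all with find (All.¬All⇒Any¬ (R? v) xs ¬all)
  ... | y , y∈xs , ¬r with ∈-∃++ y∈xs
  ...   | as , bs , refl with linked⇒walk-to rs
  ...     | w , rs′ with compare (lab v) (lab y)
  ...       | inj₁ r = ⊥-elim (¬r r)
  ...       | inj₂ (inj₁ r) with cut-out ls w r rs′
  ...         | ds , ps , cyc , path , p = inj₂ (ds , ps , cyc , path , ↭-trans p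
                (solve 5 (λ us y v as bs → us ⊕ (y ⊕ v ⊕ as) ⊕ bs ⊜ us ⊕ v ⊕ as ⊕ y ⊕ bs) ↭-refl us [ y ] [ v ] as bs))
  -- The predecessor of the twin `y` has an arc to `v` as well, which closes the segment before `y`;
  -- on the path `y` takes the place of `v`.
  transitive-or-extract {v} {us} {xs} ls rs | no ¬all | y , y∈xs , ¬r | as , bs , refl | w , rs′ | inj₂ (inj₂ eq) =
    inj₂ (_ , _ , closedWalk⇒cycle (relabel-end w (sym eq)) , join (relabel-head eq ls) rs′ ,
      ↭-trans (++⁺ˡ (v ∷ as) (ʳ++-↭ us))
        (solve 5 (λ us y v as bs → (v ⊕ as) ⊕ us ⊕ y ⊕ bs ⊜ us ⊕ v ⊕ as ⊕ y ⊕ bs) ↭-refl us [ y ] [ v ] as bs))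

  cycle-nonempty : ¬ Cycle R []
  cycle-nonempty (_ , _ , _ , _ , _ , p) with ↭-length p
  ... | ()

  -- With `AllPairs R` in place of `Linked R`, any item can later be deleted from a path.
  Decomposition : ℕ → List V → Set
  Decomposition k xs = ∃₂ λ Ds Ps → All (Cycle R) Ds × All (AllPairs R) Ps × length Ps ≤ k ×
    concat Ds ++ concat Ps ↭ xs

  -- Each extraction takes out a non-empty cycle and leaves a single path, so at most one transitive
  -- path remains in the end.
  decompose-path : ∀ n → length xs < n → Linked R xs → Decomposition 1 xs
  decompose-path {[]} _ _ _ = [] , [] , [] , [] , z≤n , ↭-refl
  decompose-path {x ∷ xs} (suc n) (s≤s lt) rs with transitive-or-extract [-] rs
  ... | inj₁ ap = [] , [ x ∷ xs ] , [] , ap ∷ [] , s≤s z≤n , ↭-reflexive (++-identityʳ _)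
  ... | inj₂ ([] , ps , cyc , _) = ⊥-elim (cycle-nonempty cyc)
  ... | inj₂ (d ∷ ds , ps , cyc , path , p) with decompose-path n lt′ path
    where
    lt′ : length ps < n
    lt′ = ℕ.<-≤-trans (s≤s (ℕ.≤-trans (ℕ.m≤n+m _ (length ds)) (ℕ.≤-reflexive (sym (length-++ ds)))))
            (ℕ.≤-trans (ℕ.≤-reflexive (↭-length p)) lt)
  ...   | Ds , Ps , cycs , chains , le , q = (d ∷ ds) ∷ Ds , Ps , cyc ∷ cycs , chains , le ,
          ↭-trans (↭-reflexive (++-assoc (d ∷ ds) (concat Ds) _)) (↭-trans (++⁺ˡ (d ∷ ds) q) p)

  decompose : ∀ Xs → All (Linked R) Xs → Decomposition (length Xs) (concat Xs)
  decompose [] [] = [] , [] , [] , [] , z≤n , ↭-refl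
  decompose (X ∷ Xs) (path ∷ paths) with decompose-path _ ℕ.≤-refl path | decompose Xs paths
  ... | Ds₁ , Ps₁ , cycs₁ , chains₁ , le₁ , p₁ | Ds₂ , Ps₂ , cycs₂ , chains₂ , le₂ , p₂ =
    Ds₁ ++ Ds₂ , Ps₁ ++ Ps₂ , All.++⁺ cycs₁ cycs₂ , All.++⁺ chains₁ chains₂ ,
    ℕ.≤-trans (ℕ.≤-reflexive (length-++ Ps₁)) (ℕ.+-mono-≤ le₁ le₂) ,
    ↭-trans (↭-reflexive (sym (cong₂ _++_ (concat-++ Ds₁ Ds₂) (concat-++ Ps₁ Ps₂))))
      (↭-trans (solve 4 (λ a b c d → (a ⊕ b) ⊕ c ⊕ d ⊜ (a ⊕ c) ⊕ b ⊕ d) ↭-refl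
                 (concat Ds₁) (concat Ds₂) (concat Ps₁) (concat Ps₂))
        (++⁺ p₁ p₂))

  -- Removing items from transitive paths and from families of cycles

  remove-from-chain : AllPairs R xs → v ∈ xs → ∃ λ ys → AllPairs R ys × v ∷ ys ↭ xs
  remove-from-chain (_ ∷ ap) (here refl) = _ , ap , ↭-refl
  remove-from-chain {x ∷ xs} (rs ∷ ap) (there v∈) with remove-from-chain ap v∈
  ... | ys , ap′ , p = x ∷ ys , All.tail (All-resp-↭ (↭-sym p) rs) ∷ ap′ ,
        ↭-trans (swap _ x ↭-refl) (prep x p)

  remove-from-chains : ∀ {Ps} → All (AllPairs R) Ps → v ∈ concat Ps →
    ∃ λ Ps′ → All (AllPairs R) Ps′ × length Ps′ ≡ length Ps × v ∷ concat Ps′ ↭ concat Ps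
  remove-from-chains {v} {P ∷ Ps} (ap ∷ aps) v∈ with ∈-++⁻ P v∈
  ... | inj₁ v∈P with remove-from-chain ap v∈P
  ...   | P′ , ap′ , p = P′ ∷ Ps , ap′ ∷ aps , refl , ++⁺ʳ (concat Ps) p
  remove-from-chains {v} {P ∷ Ps} (ap ∷ aps) v∈ | inj₂ v∈Ps with remove-from-chains aps v∈Ps
  ... | Ps′ , aps′ , eq , p = P ∷ Ps′ , ap ∷ aps′ , cong suc eq ,
        ↭-trans (↭-sym (shift v P (concat Ps′))) (++⁺ˡ P p)

  -- The hypothesis is a permutation and not an inclusion, because the items still to be removed
  -- must be present after each removal.
  remove-all-from-chains : ∀ {Ps} vs → All (AllPairs R) Ps → vs ++ zs ↭ concat Ps →
    ∃ λ Ps′ → All (AllPairs R) Ps′ × length Ps′ ≡ length Ps × vs ++ concat Ps′ ↭ concat Ps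
  remove-all-from-chains [] aps p = _ , aps , refl , ↭-refl
  remove-all-from-chains (v ∷ vs) aps p with remove-from-chains aps (∈-resp-↭ p (here refl))
  ... | Ps₁ , aps₁ , eq₁ , p₁ with remove-all-from-chains vs aps₁ (drop-∷ (↭-trans p (↭-sym p₁)))
  ...   | Ps₂ , aps₂ , eq₂ , p₂ = Ps₂ , aps₂ , trans eq₂ eq₁ , ↭-trans (prep v p₂) p₁

  remove-cycle : ∀ {Q : Pred (List V) 0ℓ} {Ds} → All Q Ds → v ∈ concat Ds →
    ∃₂ λ D Ds′ → Q D × v ∈ D × All Q Ds′ × D ++ concat Ds′ ↭ concat Ds
  remove-cycle {Ds = D ∷ Ds} (q ∷ qs) v∈ with ∈-++⁻ D v∈
  ... | inj₁ v∈D = D , Ds , q , v∈D , qs , ↭-refl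
  ... | inj₂ v∈Ds with remove-cycle qs v∈Ds
  ...   | D′ , Ds′ , q′ , v∈D′ , qs′ , p = D′ , D ∷ Ds′ , q′ , v∈D′ , q ∷ qs′ ,
          ↭-trans (shifts D′ D) (++⁺ˡ D p)

  -- Every later vertex is adjacent to `d`, so before the first one that receives an arc from `d`
  -- all vertices have arcs to `d`. The arc into that first one is the gap.
  gap-after : (w : Walk R a b xs) → R a d → (∀ {v} → v ∈ xs ∷ʳ b → R v d ⊎ R d v) →
    ∀ {e} → e ∈ arcs w → R d (proj₂ e) → Gap R? w d
  gap-after (_∷_ {b = b} r w) s adj e∈ t with R? _ b
  ... | yes t′ = _ , _ , here refl , s , t′
  gap-after (r ∷ w) s adj (here refl) t | no ¬t = ⊥-elim (¬t t)
  gap-after (_∷_ {b = b} r w) s adj (there e∈) t | no ¬t with gap-after w (reverse-arc (adj (there (head∈ w)))) (adj ∘ there) e∈ t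
    where
    head∈ : ∀ {a b xs} → Walk R a b xs → a ∈ xs ∷ʳ b
    head∈ [] = here refl
    head∈ (_ ∷ _) = here refl
    reverse-arc : R b _ ⊎ R _ b → R b _
    reverse-arc (inj₁ s′) = s′
    reverse-arc (inj₂ t′) = ⊥-elim (¬t t′)
  ... | c , c′ , e∈′ , s′ , t′ = c , c′ , there e∈′ , s′ , t′

  arc-into : (r : R a b) (w : Walk R b c xs) → v ∈ xs ∷ʳ c → ∃ λ u → (u , v) ∈ arcs (r ∷ w)
  arc-into r [] (here refl) = _ , here refl
  arc-into r (s ∷ w) (here refl) = _ , here refl
  arc-into r (s ∷ w) (there v∈) with arc-into s w v∈
  ... | u , e∈ = u , there e∈

  -- The search starts at the in-neighbour `v` of `d` and ends at `b` at the latest.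
  gap-before : (w : Walk R a b xs) → R d b → (∀ {v} → v ∈ xs ∷ʳ b → R v d ⊎ R d v) →
    v ∈ xs → R v d → Gap R? w d
  gap-before {xs = _ ∷ xs} (r ∷ w) t adj (here refl) s =
    gap-after (r ∷ w) s adj (proj₂ (arc-into r w (∈-++⁺ʳ xs (here refl)))) t
  gap-before (r ∷ w) t adj (there v∈) s with gap-before w t (adj ∘ there) v∈ s
  ... | c , c′ , e∈ , s′ , t′ = c , c′ , there e∈ , s′ , t′

  closed-∈ : ∀ {xs} → v ∈ a ∷ (xs ∷ʳ a) → v ∈ a ∷ xs
  closed-∈ (here refl) = here refl
  closed-∈ {xs = xs} (there v∈) with ∈-++⁻ xs v∈
  ... | inj₁ v∈xs = there v∈xs
  ... | inj₂ (here refl) = here refl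

  -- The base point `a` is adjacent to `d`. If it has an arc to `d`, the turn starting at `a` meets
  -- `v`, where `a` itself would be met at the end; otherwise `d` has an arc to `a`, and the stretch
  -- from `u` to `a` has a gap.
  gap-in-cycle : (r : R a b) (w : Walk R b a xs) → (∀ {v} → v ∈ a ∷ xs → R v d ⊎ R d v) →
    ∀ {u v} → u ∈ a ∷ xs → R u d → v ∈ a ∷ xs → R d v → Gap R? (r ∷ w) d
  gap-in-cycle {a = a} {xs = xs} r w adj u∈ s v∈ t with adj (here refl)
  ... | inj₁ s′ = gap-after (r ∷ w) s′ (adj ∘ closed-∈) (proj₂ (arc-into r w (rotate v∈))) t
    where
    rotate : ∀ {v} → v ∈ a ∷ xs → v ∈ xs ∷ʳ a
    rotate (here refl) = ∈-++⁺ʳ xs (here refl)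
    rotate (there v∈) = ∈-++⁺ˡ v∈
  ... | inj₂ t′ = gap-before (r ∷ w) t′ (adj ∘ closed-∈) u∈ s

  -- How items and cycles attach to a fixed cycle

  module AroundCycle {zs : List V} (C : Cycle R zs) where

    Hit HasIn HasOut : Pred I 0ℓ
    Hit q = Any (λ c → lab c ≡ q) zs
    HasIn q = Any (λ c → A (lab c) q) zs
    HasOut q = Any (λ c → A q (lab c)) zs

    hit? : Decidable Hit
    hit? q = Any.any? (λ c → lab c ≟ q) zs

    hasIn? : Decidable HasIn
    hasIn? q = Any.any? (λ c → A? (lab c) q) zs

    hasOut? : Decidable HasOut
    hasOut? q = Any.any? (λ c → A? q (lab c)) zs

    -- Whatever precedes an item on the cycle has an arc to the whole part of that item.
    hit⇒hasIn : Hit q → HasIn q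
    hit⇒hasIn hit with find hit
    ... | c , c∈ , refl with cycle-to c∈ C
    ...   | l , _ , r , _ , p = lose (∈-resp-↭ p (here refl)) r

    hit⇒hasOut : Hit q → HasOut q
    hit⇒hasOut hit with find hit
    ... | c , c∈ , refl with cycle-from c∈ C
    ...   | _ , _ , r , w , p with w
    -- A cycle with a single item would be a loop among the parts.
    ...     | [] = ⊥-elim (irr r)
    ...     | _ ∷ _ = lose (∈-resp-↭ p (there (here refl))) r

    -- By semicompleteness `q` dominates the whole cycle; `q` is not the part of `c`, since a part
    -- on the cycle has an in-neighbour there.
    noIn⇒out : ¬ HasIn q → c ∈ zs → A q (lab c)
    noIn⇒out {q} {c} ¬in c∈ with compare q (lab c)
    ... | inj₁ r = r
    ... | inj₂ (inj₁ r) = ⊥-elim (¬in (lose c∈ r))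
    ... | inj₂ (inj₂ refl) = ⊥-elim (¬in (hit⇒hasIn (lose c∈ refl)))

    noOut⇒in : ¬ HasOut q → c ∈ zs → A (lab c) q
    noOut⇒in {q} {c} ¬out c∈ with compare q (lab c)
    ... | inj₁ r = ⊥-elim (¬out (lose c∈ r))
    ... | inj₂ (inj₁ r) = r
    ... | inj₂ (inj₂ refl) = ⊥-elim (¬out (hit⇒hasOut (lose c∈ refl)))

    hub : ∃ λ c → c ∈ zs
    hub = let c , _ , _ , _ , _ , p = C in c , ∈-resp-↭ p (here refl)

    noIn⇒hasOut : ¬ HasIn q → HasOut q
    noIn⇒hasOut ¬in = lose (proj₂ hub) (noIn⇒out ¬in (proj₂ hub))

    -- The part of `l` dominates the cycle, so the detour can return to the successor of `c`.
    insert-after : c ∈ zs → R c f → Walk R f l xs → ¬ HasIn (lab l) → Cycle R ((l ∷ xs) ++ zs)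
    insert-after {l = l} {xs = xs} c∈ r w ¬in with cycle-from c∈ C
    ... | _ , _ , s , w′ , p with w′
    ...   | [] = ⊥-elim (irr s)
    ...   | _ ∷ _ = cycle-resp-↭ (++⁺ˡ (l ∷ xs) p)
            (cycle-insert w′ r w (noIn⇒out ¬in (∈-resp-↭ p (there (here refl)))))

    -- The part of `f` is dominated by the cycle, so the detour can leave from the predecessor of
    -- `c`.
    insert-before : c ∈ zs → R l c → Walk R f l xs → ¬ HasOut (lab f) → Cycle R ((l ∷ xs) ++ zs)
    insert-before {l = l} {xs = xs} c∈ r w ¬out with cycle-to c∈ C
    ... | d , ys , s , w′ , p = cycle-resp-↭ (++⁺ˡ (l ∷ xs) p) (_ , _ , _ , noOut⇒in ¬out (∈-resp-↭ p (here refl)) ,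
              w ++ʷ (r ∷ w′) , solve 4 (λ d xs l ys → d ⊕ xs ⊕ l ⊕ ys ⊜ l ⊕ xs ⊕ d ⊕ ys) ↭-refl [ d ] xs [ l ] ys)

    -- An item off the parts of the cycle is adjacent to all of it. With arcs in both directions it
    -- has a gap, and the walk is inserted piecewise into such gaps.
    insert-mixed : Walk R f l xs →
      All (λ d → ¬ Hit (lab d) × HasIn (lab d) × HasOut (lab d)) (xs ∷ʳ l) → Cycle R ((l ∷ xs) ++ zs)
    insert-mixed {l = l} {xs = xs} w mixed with cycle-from (proj₂ hub) C
    ... | c′ , ys , r , w₀ , p with multi-insert R? _ ℕ.≤-refl (r ∷ w₀) w (All.map gap mixed)
      where
      gap : ∀ {d} → ¬ Hit (lab d) × HasIn (lab d) × HasOut (lab d) → Gap R? (r ∷ w₀) d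
      gap {d} (¬hit , i , o) with find i | find o
      ... | u , u∈ , s | v , v∈ , t = gap-in-cycle r w₀ adj
            (∈-resp-↭ (↭-sym p) u∈) s (∈-resp-↭ (↭-sym p) v∈) t
        where
        adj : ∀ {v} → v ∈ proj₁ hub ∷ ys → R v d ⊎ R d v
        adj v∈ = semicomplete _ _ (λ eq → ¬hit (lose (∈-resp-↭ p v∈) eq))
    ...   | [] , _ , q = ⊥-elim (absurd (↭-length q))
      where absurd : ¬ 0 ≡ suc _
            absurd ()
    ...   | _ ∷ _ , w′ , q = cycle-resp-↭ (↭-trans q (++⁺ˡ (l ∷ xs) p)) (closedWalk⇒cycle w′)

    NoIn NoOut OneSided : Pred (List V) 0ℓ
    NoIn ds = ∀ {d} → d ∈ ds → ¬ HasIn (lab d)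
    NoOut ds = ∀ {d} → d ∈ ds → ¬ HasOut (lab d)
    OneSided ds = NoIn ds ⊎ NoOut ds

    ∷ʳ-↭ : ∀ xs → xs ∷ʳ l ↭ l ∷ xs
    ∷ʳ-↭ {l} xs = ++-comm xs [ l ]

    -- This opens a second cycle at an arc from `e` to `f` that enters `P`, so that its two ends
    -- attach differently to the fixed cycle.
    cycle-crossing : {P : Pred V 0ℓ} → Decidable P → Cycle R ds → u ∈ ds → ¬ P u → v ∈ ds → P v →
      ∃₂ λ f e → ∃ λ xs → Walk R f e xs × P f × ¬ P e × e ∷ xs ↭ ds
    cycle-crossing P? D u∈ ¬Pu v∈ Pv with cycle-to u∈ D
    ... | l , xs , r , w , p
      with crossing P? w ¬Pu (lose (∈-resp-↭ (↭-trans (↭-sym p) (↭-sym (∷ʳ-↭ xs))) v∈) Pv)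
    ... | e , f , ys , us , w₁ , s , w₂ , ¬Pe , Pf , refl = f , e , us ++ l ∷ ys , w₂ ++ʷ (r ∷ w₁) , Pf , ¬Pe ,
          ↭-trans (solve 4 (λ e us l ys → e ⊕ us ⊕ l ⊕ ys ⊜ l ⊕ ys ⊕ e ⊕ us) ↭-refl [ e ] us [ l ] ys) p

    -- The two cycles merge if they share a part, if the attachment to the fixed cycle changes along
    -- `D`, or if every item of `D` has arcs in both directions. Otherwise one direction is absent
    -- throughout.
    merge-or-oneSided : Cycle R ds → Cycle R (ds ++ zs) ⊎ OneSided ds
    merge-or-oneSided {ds} D with Any.any? (λ d → hit? (lab d)) ds
    ... | yes any with find any
    ...   | d , d∈ , hit with find hit
    -- The twins `c` and `d` exchange their successors, which joins the two cycles into one.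
    ...     | c , c∈ , eq with cycle-from c∈ C | cycle-from d∈ D
    ...       | g , xs , r , w , p | f , ys , s , w′ , q = inj₁ (cycle-resp-↭ (++⁺ q p)
                (cycle-insert w (subst (λ i → A i (lab f)) (sym eq) s) w′ (subst (λ i → A i (lab g)) eq r)))
    merge-or-oneSided {ds} D | no ¬hit with Any.any? (λ d → ¬? (hasIn? (lab d))) ds
    ... | yes any with find any
    ...   | u , u∈ , ¬in with Any.any? (λ d → hasIn? (lab d)) ds
    ...     | no none = inj₂ (inj₁ (λ d∈ i → none (lose d∈ i)))
    ...     | yes any′ with find any′
    -- `D` is opened between an `e` that dominates the fixed cycle and an `f` with an in-neighbour
    -- on it.
    ...       | v , v∈ , i with cycle-crossing (λ d → hasIn? (lab d)) D u∈ ¬in v∈ i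
    ...         | f , e , xs , w , i′ , ¬i , p with find i′
    ...           | c , c∈ , r = inj₁ (cycle-resp-↭ (++⁺ʳ zs p) (insert-after c∈ r w ¬i))
    merge-or-oneSided {ds} D | no ¬hit | no allIn with Any.any? (λ d → ¬? (hasOut? (lab d))) ds
    ... | yes any with find any
    ...   | v , v∈ , ¬out with Any.any? (λ d → hasOut? (lab d)) ds
    ...     | no none = inj₂ (inj₂ (λ d∈ o → none (lose d∈ o)))
    ...     | yes any′ with find any′
    ...       | u , u∈ , o with cycle-crossing (λ d → ¬? (hasOut? (lab d))) D u∈ (λ ¬o → ¬o o) v∈ ¬out
    ...         | f , e , xs , w , ¬o , ¬¬o , p with find (decidable-stable (hasOut? (lab e)) ¬¬o)
    ...           | c , c∈ , r = inj₁ (cycle-resp-↭ (++⁺ʳ zs p) (insert-before c∈ r w ¬o))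
    -- Every item of `D` now lies off the parts of the fixed cycle and has an in-neighbour and an
    -- out-neighbour on it.
    merge-or-oneSided {ds} D | no ¬hit | no allIn | no allOut with D
    ... | l , f , xs , _ , w , p = inj₁ (cycle-resp-↭ (++⁺ʳ zs p)
          (insert-mixed w (All.tabulate λ d∈ → mixed (∈-resp-↭ (↭-trans (∷ʳ-↭ xs) p) d∈))))
      where
      mixed : d ∈ ds → ¬ Hit (lab d) × HasIn (lab d) × HasOut (lab d)
      mixed d∈ = (λ h → ¬hit (lose d∈ h)) ,
        decidable-stable (hasIn? _) (λ ¬i → allIn (lose d∈ ¬i)) ,
        decidable-stable (hasOut? _) (λ ¬o → allOut (lose d∈ ¬o))

  -- Enlarging the cycle

  State : List V → List (List V) → List (List V) → Set
  State zs Ds Ps = Cycle R zs × All (Cycle R) Ds × All (AllPairs R) Ps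

  rest : List (List V) → List (List V) → List V
  rest Ds Ps = concat Ds ++ concat Ps

  -- The added list is non-empty, which makes the iteration stop. Transitive paths that become empty
  -- stay in the list, so their number is preserved exactly.
  Improvement : List V → List (List V) → List (List V) → Set
  Improvement zs Ds Ps = ∃₂ λ b bs → ∃₂ λ Ds′ Ps′ → State ((b ∷ bs) ++ zs) Ds′ Ps′ ×
    length Ps′ ≡ length Ps × (b ∷ bs) ++ rest Ds′ Ps′ ↭ rest Ds Ps

  module Enlarge (parts : List I) (all-parts : ∀ q → q ∈ parts) (connected : ∀ p q → Star A p q)
    {zs Ds Ps} (state : State zs Ds Ps) (rep : ∀ q → ∃ λ v → v ∈ zs ++ rest Ds Ps × lab v ≡ q) where

    open AroundCycle (proj₁ state)

    Side : List (List V) → Set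
    Side = All (λ D → Cycle R D × OneSided D)

    merge-or-side : ∀ {Ds} → All (Cycle R) Ds →
      (∃₂ λ D Ds′ → Cycle R D × Cycle R (D ++ zs) × All (Cycle R) Ds′ × D ++ concat Ds′ ↭ concat Ds) ⊎ Side Ds
    merge-or-side [] = inj₂ []
    merge-or-side {D ∷ Ds} (cyc ∷ cycs) with merge-or-oneSided cyc
    ... | inj₁ cyc′ = inj₁ (D , Ds , cyc , cyc′ , cycs , ↭-refl)
    ... | inj₂ side with merge-or-side cycs
    ...   | inj₂ sides = inj₂ ((cyc , side) ∷ sides)
    ...   | inj₁ (D′ , Ds′ , cyc₁ , cyc₂ , cycs′ , p) = inj₁ (D′ , D ∷ Ds′ , cyc₁ , cyc₂ , cyc ∷ cycs′ ,
            ↭-trans (shifts D′ D) (++⁺ˡ D p))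

    -- This is what has to leave the rest together with `v`: an item of a transitive path goes
    -- alone, an item of a cycle takes its whole cycle along.
    Component : V → List (List V) → List (List V) → List V → Set
    Component v Ds Ps bs = (bs ≡ [ v ] ⊎ Cycle R bs × OneSided bs × v ∈ bs) ×
      ∃₂ λ Ds′ Ps′ → Side Ds′ × All (AllPairs R) Ps′ × length Ps′ ≡ length Ps × bs ++ rest Ds′ Ps′ ↭ rest Ds Ps

    component : ∀ {Ds Ps} → Side Ds → All (AllPairs R) Ps → v ∈ rest Ds Ps → ∃ (Component v Ds Ps)
    component {v} {Ds} {Ps} side chains v∈ with ∈-++⁻ (concat Ds) v∈
    ... | inj₁ v∈Ds with remove-cycle side v∈Ds
    ...   | D , Ds′ , (cyc , oneSided) , v∈D , side′ , p =
            D , inj₂ (cyc , oneSided , v∈D) , Ds′ , Ps , side′ , chains , refl ,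
            ↭-trans (↭-reflexive (sym (++-assoc D (concat Ds′) _))) (++⁺ʳ (concat Ps) p)
    component {v} {Ds} {Ps} side chains v∈ | inj₂ v∈Ps with remove-from-chains chains v∈Ps
    ... | Ps′ , chains′ , eq , p = [ v ] , inj₁ refl , Ds , Ps′ , side , chains′ , eq ,
          ↭-trans (↭-sym (shift v (concat Ds) (concat Ps′))) (++⁺ˡ (concat Ds) p)

    rep-outside : ¬ Hit q → ∃ λ v → v ∈ rest Ds Ps × lab v ≡ q
    rep-outside {q} ¬hit with rep q
    ... | v , v∈ , eq with ∈-++⁻ zs v∈
    ...   | inj₁ v∈zs = ⊥-elim (¬hit (lose v∈zs eq))
    ...   | inj₂ v∈rest = v , v∈rest , eq

    -- The relation `E` serves to pin one end of the block to a given item, where another block or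
    -- the cycle is to be attached.
    Block : Pred I 0ℓ → List (List V) → List (List V) → (V → V → Set) → Set
    Block Q Ds Ps E = ∃₂ λ f l → ∃ λ xs → Walk R f l xs × E f l × (∀ {d} → d ∈ l ∷ xs → Q (lab d)) ×
      ∃₂ λ Ds′ Ps′ → Side Ds′ × All (AllPairs R) Ps′ × length Ps′ ≡ length Ps × (l ∷ xs) ++ rest Ds′ Ps′ ↭ rest Ds Ps

    -- A cycle through `v` is one-sided. Since `v` dominates the fixed cycle, the side must be
    -- `NoIn`, and going around from `v` gives the block.
    block-from : ∀ {Ds Ps} → Side Ds → All (AllPairs R) Ps → v ∈ rest Ds Ps → ¬ HasIn (lab v) →
      Block (¬_ ∘ HasIn) Ds Ps (λ f l → f ≡ v)
    block-from side chains v∈ ¬in with component side chains v∈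
    ... | _ , inj₁ refl , Ds′ , Ps′ , more = _ , _ , [] , [] , refl , (λ { (here refl) → ¬in }) , Ds′ , Ps′ , more
    ... | _ , inj₂ (_ , inj₂ noOut , v∈D) , _ = ⊥-elim (noOut v∈D (noIn⇒hasOut ¬in))
    ... | _ , inj₂ (cyc , inj₁ noIn , v∈D) , Ds′ , Ps′ , side′ , chains′ , eq , q with cycle-to v∈D cyc
    ...   | l , xs , _ , w , p = _ , l , xs , w , refl , noIn ∘ ∈-resp-↭ p , Ds′ , Ps′ , side′ , chains′ , eq ,
            ↭-trans (++⁺ʳ (rest Ds′ Ps′) p) q

    block-to : ∀ {Ds Ps} → Side Ds → All (AllPairs R) Ps → v ∈ rest Ds Ps → ¬ HasOut (lab v) →
      Block (¬_ ∘ HasOut) Ds Ps (λ f l → l ≡ v)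
    block-to side chains v∈ ¬out with component side chains v∈
    ... | _ , inj₁ refl , Ds′ , Ps′ , more = _ , _ , [] , [] , refl , (λ { (here refl) → ¬out }) , Ds′ , Ps′ , more
    ... | _ , inj₂ (_ , inj₁ noIn , v∈D) , _ = ⊥-elim (¬out (noIn⇒hasOut (noIn v∈D)))
    ... | _ , inj₂ (cyc , inj₂ noOut , v∈D) , Ds′ , Ps′ , side′ , chains′ , eq , q with cycle-from v∈D cyc
    ...   | f , xs , _ , w , p = f , _ , xs , w , refl , noOut ∘ ∈-resp-↭ p , Ds′ , Ps′ , side′ , chains′ , eq ,
            ↭-trans (++⁺ʳ (rest Ds′ Ps′) p) q

    first∈ : Walk R f l xs → f ∈ l ∷ xs
    first∈ [] = here refl
    first∈ (_ ∷ _) = there (here refl)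

    module _ (side : Side Ds) where

      private
        chains : All (AllPairs R) Ps
        chains = proj₂ (proj₂ state)

      enter-noIn : Hit p → A p q → ¬ HasIn q → Improvement zs Ds Ps
      enter-noIn hit r ¬in with find hit | rep-outside (¬in ∘ hit⇒hasIn)
      ... | c , c∈ , refl | v , v∈ , refl with block-from side chains v∈ ¬in
      ...   | _ , l , xs , w , refl , noIn , Ds′ , Ps′ , side′ , chains′ , eq , p =
              l , xs , Ds′ , Ps′ , (insert-after c∈ r w (noIn (here refl)) , All.map proj₁ side′ , chains′) , eq , p

      leave-noOut : ¬ HasOut p → A p q → Hit q → Improvement zs Ds Ps
      leave-noOut ¬out r hit with find hit | rep-outside (¬out ∘ hit⇒hasOut)
      ... | c , c∈ , refl | v , v∈ , refl with block-to side chains v∈ ¬out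
      ...   | f , _ , xs , w , refl , noOut , Ds′ , Ps′ , side′ , chains′ , eq , p =
              v , xs , Ds′ , Ps′ , (insert-before c∈ r w (noOut (first∈ w)) , All.map proj₁ side′ , chains′) , eq , p

      -- The fixed cycle dominates `p`, and `q` dominates it, so the arc from `p` to `q` yields a
      -- detour that fits anywhere; its ends are extended around the one-sided cycles they lie on.
      noOut-to-noIn : ¬ HasOut p → A p q → ¬ HasIn q → Improvement zs Ds Ps
      noOut-to-noIn ¬out r ¬in with rep-outside (¬out ∘ hit⇒hasOut) | rep-outside (¬in ∘ hit⇒hasIn)
      ... | v , v∈ , refl | u , u∈ , refl with block-to side chains v∈ ¬out
      ...   | f , _ , xs , w , refl , noOut , Ds′ , Ps′ , side′ , chains′ , eq , p
        with ∈-++⁻ (v ∷ xs) (∈-resp-↭ (↭-sym p) u∈)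
      -- The blocks do not overlap: `u` dominates the fixed cycle, while no item of the first block
      -- has an arc to it.
      ...     | inj₁ u∈block = ⊥-elim (noOut u∈block (noIn⇒hasOut ¬in))
      ...     | inj₂ u∈rest with block-from side′ chains′ u∈rest ¬in
      ...       | _ , l , ys , w′ , refl , noIn , Ds″ , Ps″ , side″ , chains″ , eq′ , p′ =
        l , xs ++ v ∷ ys , Ds″ , Ps″ ,
        (insert-after (proj₂ hub) (noOut⇒in (noOut (first∈ w)) (proj₂ hub)) (w ++ʷ (r ∷ w′)) (noIn (here refl)) ,
         All.map proj₁ side″ , chains″) ,
        trans eq′ eq ,
        ↭-trans (↭-trans
          (solve 5 (λ l xs v ys z → (l ⊕ xs ⊕ v ⊕ ys) ⊕ z ⊜ (v ⊕ xs) ⊕ (l ⊕ ys) ⊕ z) ↭-refl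
            [ l ] xs [ v ] ys (rest Ds″ Ps″))
          (++⁺ˡ (v ∷ xs) p′)) p

      -- An item of `q` cannot lie on a one-sided cycle, so it comes from a transitive path and can
      -- be moved alone.
      insert-single : ¬ Hit q → HasIn q → HasOut q → Improvement zs Ds Ps
      insert-single ¬hit i o with rep-outside ¬hit
      ... | v , v∈ , refl with component side chains v∈
      ...   | _ , inj₂ (_ , inj₁ noIn , v∈D) , _ = ⊥-elim (noIn v∈D i)
      ...   | _ , inj₂ (_ , inj₂ noOut , v∈D) , _ = ⊥-elim (noOut v∈D o)
      ...   | _ , inj₁ refl , Ds′ , Ps′ , side′ , chains′ , eq , p =
              v , [] , Ds′ , Ps′ , (insert-mixed [] ((¬hit , i , o) ∷ []) , All.map proj₁ side′ , chains′) , eq , p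

      -- If `q` attaches in one direction only, a walk between the cycle and `q` has an arc where
      -- having an in-neighbour, or an out-neighbour, on the cycle changes. How the other end of
      -- that arc attaches decides which insertion applies.
      hit-more : ¬ Hit q → Improvement zs Ds Ps
      hit-more {q} ¬hit with hasIn? q
      ... | no ¬in with crossing★ (¬? ∘ hasIn?) (connected (lab (proj₁ hub)) q)
                          (λ ¬i → ¬i (hit⇒hasIn (lose (proj₂ hub) refl))) ¬in
      ...   | e , f , r , ¬¬i , ¬i with hit? e
      ...     | yes hit = enter-noIn hit r ¬i
      ...     | no ¬hit′ with hasOut? e
      ...       | no ¬o = noOut-to-noIn ¬o r ¬i
      ...       | yes o = insert-single ¬hit′ (decidable-stable (hasIn? e) ¬¬i) o
      hit-more {q} ¬hit | yes i with hasOut? q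
      ... | yes o = insert-single ¬hit i o
      ... | no ¬out with crossing★ hasOut? (connected q (lab (proj₁ hub))) ¬out (hit⇒hasOut (lose (proj₂ hub) refl))
      ...   | e , f , r , ¬o , o with hit? f
      ...     | yes hit = leave-noOut ¬o r hit
      ...     | no ¬hit′ with hasIn? f
      ...       | no ¬i = noOut-to-noIn ¬o r ¬i
      ...       | yes i′ = insert-single ¬hit′ i′ o

    -- Once every part is hit, every part has arcs from and to the cycle, so no one-sided cycle is
    -- left.
    spanning-or-improve : (Ds ≡ [] × (∀ q → Hit q)) ⊎ Improvement zs Ds Ps
    spanning-or-improve with merge-or-side (proj₁ (proj₂ state))
    ... | inj₁ ([] , _ , cyc , _) = ⊥-elim (cycle-nonempty cyc)
    ... | inj₁ (d ∷ D , Ds′ , _ , cyc , cycs , p) = inj₂ (d , D , Ds′ , Ps , (cyc , cycs , proj₂ (proj₂ state)) , refl ,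
          ↭-trans (↭-reflexive (sym (++-assoc (d ∷ D) (concat Ds′) _))) (++⁺ʳ (concat Ps) p))
    ... | inj₂ side with All.all? hit? parts
    ...   | no ¬all with find (All.¬All⇒Any¬ hit? parts ¬all)
    ...     | q , _ , ¬hit = inj₂ (hit-more side ¬hit)
    spanning-or-improve | inj₂ side | yes all = inj₁ (no-side side , hits)
      where
      hits : ∀ q → Hit q
      hits q = All.lookup all (all-parts q)
      no-side : ∀ {Ds} → Side Ds → Ds ≡ []
      no-side [] = refl
      no-side ((cyc@(_ , _ , _ , _ , _ , p) , inj₁ noIn) ∷ _) = ⊥-elim (noIn (∈-resp-↭ p (here refl)) (hit⇒hasIn (hits _)))
      no-side ((cyc@(_ , _ , _ , _ , _ , p) , inj₂ noOut) ∷ _) = ⊥-elim (noOut (∈-resp-↭ p (here refl)) (hit⇒hasOut (hits _)))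

  -- Reaching a cycle through all parts

  module _ (parts : List I) (all-parts : ∀ q → q ∈ parts) (connected : ∀ p q → Star A p q)
    (items : List V) (rep : ∀ q → ∃ λ v → v ∈ items × lab v ≡ q) where

    SpanningCycle : ℕ → Set
    SpanningCycle k = ∃₂ λ zs Ps → Cycle R zs × All (AllPairs R) Ps × length Ps ≤ k ×
      zs ++ concat Ps ↭ items × (∀ q → Any (λ c → lab c ≡ q) zs)

    enlarge : ∀ n {zs Ds Ps} → length (rest Ds Ps) < n → State zs Ds Ps → length Ps ≤ k →
      zs ++ rest Ds Ps ↭ items → SpanningCycle k
    enlarge (suc n) {zs} {Ds} {Ps} (s≤s lt) state le p
      with Enlarge.spanning-or-improve parts all-parts connected state
             (λ q → let v , v∈ , eq = rep q in v , ∈-resp-↭ (↭-sym p) v∈ , eq)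
    ... | inj₁ (refl , hits) = zs , Ps , proj₁ state , proj₂ (proj₂ state) , le , p , hits
    ... | inj₂ (b , bs , Ds′ , Ps′ , state′ , eq , q) = enlarge n lt′ state′ (subst (_≤ _) (sym eq) le)
          (↭-trans (↭-trans (solve 3 (λ b z r → (b ⊕ z) ⊕ r ⊜ z ⊕ b ⊕ r) ↭-refl (b ∷ bs) zs (rest Ds′ Ps′)) (++⁺ˡ zs q)) p)
      where
      lt′ : length (rest Ds′ Ps′) < n
      lt′ = ℕ.<-≤-trans (s≤s (ℕ.≤-trans (ℕ.m≤n+m _ (length bs)) (ℕ.≤-reflexive (sym (length-++ bs)))))
              (ℕ.≤-trans (ℕ.≤-reflexive (↭-length q)) lt)

    lift-walk : (g : I → V) → (∀ q → lab (g q) ≡ q) → ∀ {qs} → Walk A p q qs → Walk R (g p) (g q) (map g qs)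
    lift-walk g lab-g [] = []
    lift-walk g lab-g (_∷_ {a} {b} r w) = subst (λ i → A i _) (sym (lab-g a)) (subst (A a) (sym (lab-g b)) r) ∷ lift-walk g lab-g w

    spanning-cycle : ∀ {qs} → Cycle A qs → Unique qs → ∀ Xs → All (Linked R) Xs → concat Xs ↭ items →
      SpanningCycle (length Xs)
    spanning-cycle {qs} cyc uniq Xs paths p with decompose Xs paths
    ... | D ∷ Ds , Ps , cycD ∷ cycs , chains , le , q =
          enlarge _ ℕ.≤-refl (cycD , cycs , chains) le
            (↭-trans (↭-reflexive (sym (++-assoc D (concat Ds) _))) (↭-trans q p))
    -- If the paths split off no cycle, a cycle among the parts is lifted to representatives. These
    -- all lie on transitive paths and can be removed from them.
    ... | [] , Ps , [] , chains , le , q with unique-⊆⇒↭ (unique-map uniq) reps⊆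
      where
      g : I → V
      g = proj₁ ∘ rep
      lab-g : ∀ q → lab (g q) ≡ q
      lab-g = proj₂ ∘ proj₂ ∘ rep
      unique-map : Unique qs → Unique (map g qs)
      unique-map = Unique.map⁺ λ {x} {y} eq → trans (sym (lab-g x)) (trans (cong lab eq) (lab-g y))
      reps⊆ : ∀ {v} → v ∈ map g qs → v ∈ concat Ps
      reps⊆ v∈ with ∈-map⁻ g v∈
      ... | i , _ , refl = ∈-resp-↭ (↭-sym (↭-trans q p)) (proj₁ (proj₂ (rep i)))
    ...   | us , us↭ with remove-all-from-chains (map (proj₁ ∘ rep) qs) chains us↭ | cyc
    ...     | Ps′ , chains′ , eq , q′ | l , f , xs , r , w , p′ =
      enlarge _ ℕ.≤-refl (cyc′ , [] , chains′) (subst (_≤ _) (sym eq) le) (↭-trans q′ (↭-trans q p))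
      where
      cyc′ : Cycle R (map (proj₁ ∘ rep) qs)
      cyc′ = cycle-resp-↭ (map⁺ (proj₁ ∘ rep) p′)
               (closedWalk⇒cycle (lift-walk (proj₁ ∘ rep) (proj₂ ∘ proj₂ ∘ rep) (r ∷ w)))

-- Ear decompositions

module _ {A : Set} {R : Rel A 0ℓ} where

  private variable
    a b v : A
    xs : List A

  star⇒walk : (w : Star R a b) → ∃ λ xs → Walk R a b xs × xs ∷ʳ b ≡ visited w
  star⇒walk ε = [] , [] , refl
  star⇒walk (r ◅ w) with star⇒walk w
  ... | xs , w′ , eq = _ ∷ xs , r ∷ w′ , cong (_ ∷_) eq

  suffix-path : (w : Star R a b) → Unique (visited w) → v ∈ visited w → Σ (Star R v b) (Unique ∘ visited)
  suffix-path ε u (here refl) = ε , u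
  suffix-path (r ◅ w) u (here refl) = r ◅ w , u
  suffix-path (r ◅ w) (_ ∷ u) (there v∈) = suffix-path w u v∈

  loop-erase : Binary.DecidableEquality A → Star R a b → Σ (Star R a b) (Unique ∘ visited)
  loop-erase _≟_ ε = ε , [] ∷ []
  loop-erase {a = a} _≟_ (r ◅ w) with loop-erase _≟_ w
  ... | w′ , u with DecMembership._∈?_ _≟_ a (visited w′)
  ...   | yes a∈ = suffix-path w′ u a∈
  ...   | no a∉ = r ◅ w′ , All.tabulate (λ v∈ → λ { refl → a∉ v∈ }) ∷ u

  first-hit : {P : Pred A 0ℓ} → Decidable P → Walk R a b xs → P b →
    ∃ λ e → ∃₂ λ ys zs → Walk R a e ys × P e × All (¬_ ∘ P) ys × xs ≡ ys ++ zs
  first-hit P? [] Pb = _ , [] , [] , [] , Pb , [] , refl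
  first-hit {a = a} P? (r ∷ w) Pb with P? a
  ... | yes Pa = a , [] , _ , [] , Pa , [] , refl
  ... | no ¬Pa with first-hit P? w Pb
  ...   | e , ys , zs , w′ , Pe , ¬P , refl = e , _ ∷ ys , zs , r ∷ w′ , Pe , ¬Pa ∷ ¬P , refl

  -- The second vertex `b` guarantees an arc leaving `a`; a path from its head back to `a` closes
  -- the cycle.
  exists-cycle : Binary.DecidableEquality A → (∀ a b → Star R a b) → a ≢ b → ∃ λ zs → Cycle R zs × Unique zs
  exists-cycle {a} {b} _≟_ connected a≢b with connected a b
  ... | ε = ⊥-elim (a≢b refl)
  ... | _◅_ {j = c} r _ with loop-erase _≟_ (connected c a)
  ...   | p , u with star⇒walk p
  ...     | xs , w , eq = a ∷ xs , closedWalk⇒cycle (r ∷ w) ,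
            unique-resp-↭ (++-comm xs [ a ]) (subst Unique (sym eq) u)

IsPath : {A : Set} → Rel A 0ℓ → List A → Set
IsPath R xs = ∃₂ λ a b → ∃ λ ys → Walk R a b ys × xs ≡ ys ∷ʳ b

module _ {A : Set} (R : Rel A 0ℓ) where

  -- This is what a Hamiltonian cycle of `H_k` leaves behind on the old vertices: a cycle for k = 0,
  -- otherwise k paths.
  data Cover : ℕ → List A → Set where
    cycle : ∀ {xs} → Cycle R xs → Cover 0 xs
    paths : ∀ {xs P Ps} → All (IsPath R) (P ∷ Ps) → concat (P ∷ Ps) ↭ xs → Cover (suc (length Ps)) xs

module _ {A : Set} {R S : Rel A 0ℓ} (R⇒S : R ⇒ S) where

  cycle-map : ∀ {xs} → Cycle R xs → Cycle S xs
  cycle-map (l , f , xs , r , w , p) = l , f , xs , R⇒S r , mapʷ w (λ e∈ → R⇒S (arcs⊆ w e∈)) , p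

  cover-map : ∀ {j xs} → Cover R j xs → Cover S j xs
  cover-map (cycle cyc) = cycle (cycle-map cyc)
  cover-map (paths ps p) =
    paths (All.map (λ (a , b , ys , w , eq) → a , b , ys , mapʷ w (λ e∈ → R⇒S (arcs⊆ w e∈)) , eq) ps) p

module Ears (D : Digraph) (connected : ∀ a b → Star (Digraph.Arc D) a b) where

  open Digraph D using (vertices; distinct; complete; Arc; arc?)
  open DecMembership (Digraph._≟_ D) using (_∈?_)

  -- A partial ear decomposition. Both ends of each collected arc lie in `xs`, which keeps the arcs
  -- of a new ear distinct from the old ones.
  record Partial (xs : List (Vertex D)) : Set where
    field
      unique    : Unique xs
      arcList   : List (Vertex D × Vertex D)
      arcUnique : Unique arcList
      isArc     : ∀ {a b} → (a , b) ∈ arcList → Arc a b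
      source∈   : ∀ {a b} → (a , b) ∈ arcList → a ∈ xs
      target∈   : ∀ {a b} → (a , b) ∈ arcList → b ∈ xs
      ears      : ℕ
      cover     : Cover Arc ears xs
      count     : length xs + ears ≤ length arcList

  open Partial

  start : ∀ {a b} → a ≢ b → ∃₂ λ x xs → Partial (x ∷ xs)
  start a≢b with exists-cycle (Digraph._≟_ D) connected a≢b
  ... | zs , (l , f , xs , r , w , p) , u = l , xs , record
    { unique    = u′
    ; arcList   = arcs (r ∷ w)
    ; arcUnique = unique-arcs (r ∷ w) u′
    ; isArc     = arcs⊆ (r ∷ w)
    ; source∈   = arc-source (r ∷ w)
    ; target∈   = λ e∈ → closed (arc-target (r ∷ w) e∈)
    ; ears      = 0
    ; cover     = cycle (closedWalk⇒cycle (r ∷ w))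
    ; count     = ℕ.≤-reflexive (trans (ℕ.+-identityʳ _) (sym (length-arcs (r ∷ w))))
    }
    where
    u′ : Unique (l ∷ xs)
    u′ = unique-resp-↭ (↭-sym p) u
    closed : ∀ {v} → v ∈ (l ∷ xs) ∷ʳ l → v ∈ l ∷ xs
    closed v∈ with ∈-++⁻ (l ∷ xs) v∈
    ... | inj₁ v∈′ = v∈′
    ... | inj₂ (here refl) = here refl

  -- The first ear is appended to the cycle cut open at the start of the ear,
  -- which is why a cycle and j ears are covered by j paths rather than j + 1.
  add-ear : ∀ {xs a b e ws} → Partial xs → a ∈ xs → Arc a b → Walk Arc b e ws → e ∈ xs →
    b ∉ xs → All (_∉ xs) ws → Unique ws → Partial (ws ++ xs)
  add-ear _ _ _ [] e∈ b∉ _ _ = ⊥-elim (b∉ e∈)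
  add-ear {xs} {a} {b} {e} {ws} P a∈ r w@(r₁ ∷ w₁) e∈ b∉ ws∉ u = record
    { unique    = Unique.++⁺ u (unique P) λ (v∈ws , v∈xs) → All.lookup ws∉ v∈ws v∈xs
    ; arcList   = (a , b) ∷ arcs w ++ arcList P
    ; arcUnique = All.tabulate new ∷ Unique.++⁺ (unique-arcs w u) (arcUnique P)
                    (λ (e∈w , e∈P) → All.lookup ws∉ (arc-source w e∈w) (source∈ P e∈P))
    ; isArc     = λ { (here refl) → r ; (there e∈) → either (arcs⊆ w) (isArc P) e∈ }
    ; source∈   = λ { (here refl) → ∈-++⁺ʳ ws a∈
                    ; (there e∈) → either (∈-++⁺ˡ ∘ arc-source w) (∈-++⁺ʳ ws ∘ source∈ P) e∈ }
    ; target∈   = λ { (here refl) → here refl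
                    ; (there e∈) → either (target′ ∘ arc-target w) (∈-++⁺ʳ ws ∘ target∈ P) e∈ }
    ; ears      = suc (ears P)
    ; cover     = cover′ (cover P)
    ; count     = count′
    }
    where
    either : ∀ {Z : Set} {v} → (v ∈ arcs w → Z) → (v ∈ arcList P → Z) → v ∈ arcs w ++ arcList P → Z
    either f g v∈ with ∈-++⁻ (arcs w) v∈
    ... | inj₁ v∈w = f v∈w
    ... | inj₂ v∈P = g v∈P

    -- The first arc of the ear starts in `xs`, unlike the arcs of `w`, and ends outside, unlike the
    -- arcs collected before.
    new : ∀ {v} → v ∈ arcs w ++ arcList P → (a , b) ≢ v
    new v∈ refl = either (λ e∈ → All.lookup ws∉ (arc-source w e∈) a∈) (λ e∈ → b∉ (target∈ P e∈)) v∈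

    target′ : ∀ {v} → v ∈ ws ∷ʳ e → v ∈ ws ++ xs
    target′ v∈ with ∈-++⁻ ws v∈
    ... | inj₁ v∈ws = ∈-++⁺ˡ v∈ws
    ... | inj₂ (here refl) = ∈-++⁺ʳ ws e∈

    cover′ : ∀ {j} → Cover Arc j xs → Cover Arc (suc j) (ws ++ xs)
    cover′ (paths ps p) with unsnocʷ r₁ w₁
    ... | d , ys , w′ , _ , eq = paths ((b , d , ys , w′ , eq) ∷ ps) (++⁺ˡ ws p)
    cover′ (cycle cyc) with unsnocʷ r₁ w₁ | cycle-from a∈ cyc
    ... | d , ys , w′ , _ , eq | f , zs , _ , w₀ , p =
      paths {Ps = []} ((f , d , zs ++ a ∷ ys , w₀ ++ʷ (r ∷ w′) , refl) ∷ [])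
        (↭-trans (solve 4 (λ zs a ys d → ((zs ⊕ a ⊕ ys) ⊕ d) ⊕ Perm.id ⊜ (ys ⊕ d) ⊕ a ⊕ zs) ↭-refl zs [ a ] ys [ d ])
          (++⁺ (↭-reflexive (sym eq)) p))

    count′ : length (ws ++ xs) + suc (ears P) ≤ suc (length (arcs w ++ arcList P))
    count′ = begin
      length (ws ++ xs) + suc (ears P)          ≡⟨ ℕ.+-suc (length (ws ++ xs)) (ears P) ⟩
      suc (length (ws ++ xs) + ears P)          ≡⟨ cong (λ n → suc (n + ears P)) (length-++ ws) ⟩
      suc (length ws + length xs + ears P)      ≡⟨ cong suc (ℕ.+-assoc (length ws) _ _) ⟩
      suc (length ws + (length xs + ears P))    ≤⟨ s≤s (ℕ.+-monoʳ-≤ (length ws) (count P)) ⟩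
      suc (length ws + length (arcList P))      ≡⟨ cong (λ n → suc (n + length (arcList P))) (length-arcs w) ⟨
      suc (length (arcs w) + length (arcList P)) ≡⟨ cong suc (length-++ (arcs w)) ⟨
      suc (length (arcs w ++ arcList P))        ∎
      where open ℕ.≤-Reasoning

  length≤size : ∀ {L} → Unique L → (∀ {a b} → (a , b) ∈ L → Arc a b) → length L ≤ size D
  length≤size u isArc = unique-⊆⇒length≤ u λ {(a , b)} e∈ →
    ∈-filter⁺ (λ (a , b) → arc? a b) (∈-cartesianProduct⁺ (complete a) (complete b)) (isArc e∈)

  -- While a vertex is missing, some arc leaves the current set; a path back to `x`, followed until
  -- it first returns to the set, completes an ear. The number `n` bounds the missing vertices.
  complete-ears : ∀ n {x xs} → order D ≤ length (x ∷ xs) + n → Partial (x ∷ xs) →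
    ∃ λ j → order D + j ≤ size D × Cover Arc j vertices
  complete-ears n {x} {xs} le P with All.all? (_∈? (x ∷ xs)) vertices
  ... | yes all = ears P , ℕ.≤-trans (ℕ.≤-reflexive (cong (_+ ears P) (sym (↭-length p))))
                    (ℕ.≤-trans (count P) (length≤size (arcUnique P) (isArc P))) ,
                  cover-resp p (cover P)
    where
    p : x ∷ xs ↭ vertices
    p = unique-⊆⊇⇒↭ (unique P) distinct (λ _ → complete _) (All.lookup all)
    cover-resp : ∀ {j xs ys} → xs ↭ ys → Cover Arc j xs → Cover Arc j ys
    cover-resp p (cycle cyc) = cycle (cycle-resp-↭ p cyc)
    cover-resp p (paths ps q) = paths ps (↭-trans q p)
  ... | no ¬all with find (All.¬All⇒Any¬ (_∈? (x ∷ xs)) vertices ¬all)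
  ...   | v , _ , v∉ with n
  ...     | ℕ.zero = ⊥-elim (ℕ.<-irrefl refl (ℕ.≤-trans longer (subst (order D ≤_) (ℕ.+-identityʳ _) le)))
    where
    longer : length (v ∷ x ∷ xs) ≤ order D
    longer = unique-⊆⇒length≤ (All.tabulate (λ u∈ → λ { refl → v∉ u∈ }) ∷ unique P) (λ _ → complete _)
  ...     | suc n
    with crossing★ (λ v → ¬? (v ∈? (x ∷ xs))) (connected x v) (λ x∉ → x∉ (here refl)) v∉
  ...       | a , b , r , ¬¬a∈ , b∉ with loop-erase (Digraph._≟_ D) (connected b x)
  ...         | path , u with star⇒walk path
  ...           | ys , w , eq with first-hit (_∈? (x ∷ xs)) w (here refl)
  ...             | e , ws , zs , w′ , e∈ , ws∉ , refl
    with add-ear P (decidable-stable (a ∈? (x ∷ xs)) ¬¬a∈) r w′ e∈ b∉ ws∉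
           (unique-++ˡ ws (unique-++ˡ (ws ++ zs) (subst Unique (sym eq) u)))
  ...               | P′ with ws
  ...                 | [] with w′
  ...                   | [] = ⊥-elim (b∉ e∈)
  complete-ears n {x} {xs} le P | no ¬all | v , _ , v∉ | suc n′ | a , b , r , ¬¬a∈ , b∉
    | path , u | ys , w , eq | e , ws , zs , w′ , e∈ , ws∉ , refl | P′ | y ∷ ys′ =
    complete-ears n′ (ℕ.≤-trans le le′) P′
    where
    le′ : length (x ∷ xs) + suc n′ ≤ suc (length (ys′ ++ x ∷ xs)) + n′
    le′ = ℕ.≤-trans (ℕ.≤-reflexive (ℕ.+-suc (length (x ∷ xs)) n′))
      (s≤s (ℕ.+-monoˡ-≤ n′ (ℕ.≤-trans (ℕ.m≤n+m _ (length ys′)) (ℕ.≤-reflexive (sym (length-++ ys′ {x ∷ xs}))))))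

  cover-by-ears : ∀ {a b : Vertex D} → a ≢ b → ∃ λ j → order D + j ≤ size D × Cover Arc j vertices
  cover-by-ears a≢b = let x , xs , P = start a≢b in complete-ears (order D) (ℕ.m≤n+m _ (length (x ∷ xs))) P

-- Hamiltonian cycles of H_k(D) as covers by k paths

module _ (D : Digraph) where

  open Digraph D using (vertices; distinct; complete; Arc)

  cycle⇒hamiltonian : Cycle Arc vertices → Hamiltonian D
  cycle⇒hamiltonian (l , f , xs , r , w , p) = l , xs ,
    (unique-resp-↭ (↭-sym p) distinct , walk⇒linked (r ∷ w)) , λ u → ∈-resp-↭ (↭-sym p) (complete u)

  hamiltonian⇒cycle : Hamiltonian D → Cycle Arc vertices
  hamiltonian⇒cycle (v , vs , (u , links) , all) =
    cycle-resp-↭ (unique-⊆⊇⇒↭ u distinct (λ _ → complete _) (λ _ → all _)) (closedWalk⇒cycle (linked⇒walk links))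

module _ (D : Digraph) (k : ℕ) where

  open Digraph D using (vertices; Arc)

  private
    E : Rel (ExtVertex k D) 0ℓ
    E = ExtArc k D

  old-walk : ∀ {a b xs} → Walk Arc a b xs → Walk E (old a) (old b) (map old xs)
  old-walk [] = []
  old-walk (r ∷ w) = old-old r ∷ old-walk w

  tour : ∀ Ps → (Fin (length Ps) → Fin k) → List (ExtVertex k D)
  tour [] f = []
  tour (P ∷ Ps) f = Defs.y (f zero) ∷ map old P ++ Defs.x (f zero) ∷ tour Ps (f ∘ suc)

  -- The end `y g` stays arbitrary, because in recursive calls it is the first vertex of the whole
  -- tour. Likewise `f` is the identity at the outset and shifted afterwards.
  tour-walk : ∀ {P Ps} → All (IsPath Arc) (P ∷ Ps) → (f : Fin (length (P ∷ Ps)) → Fin k) → ∀ g →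
    Walk E (Defs.y (f zero)) (Defs.y g) (tour (P ∷ Ps) f)
  tour-walk {Ps = Ps} ((a , b , ys , w , refl) ∷ ps) f g =
    y-old ∷ subst (Walk E _ _) (sym eq) (old-walk w ++ʷ (old-x ∷ rest ps f))
    where
    eq : map old (ys ∷ʳ b) ++ Defs.x (f zero) ∷ tour Ps (f ∘ suc) ≡
         map old ys ++ old b ∷ Defs.x (f zero) ∷ tour Ps (f ∘ suc)
    eq = trans (cong (_++ Defs.x (f zero) ∷ tour Ps (f ∘ suc)) (map-++ old ys [ b ])) (++-assoc (map old ys) [ old b ] _)
    rest : ∀ {Ps} → All (IsPath Arc) Ps → (f : Fin (suc (length Ps)) → Fin k) →
      Walk E (Defs.x (f zero)) (Defs.y g) (Defs.x (f zero) ∷ tour Ps (f ∘ suc))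
    rest [] f = x-y ∷ []
    rest ps@(_ ∷ _) f = x-y ∷ tour-walk ps (f ∘ suc) g

  tour-↭ : ∀ Ps f → tour Ps f ↭ map old (concat Ps) ++ map Defs.x (tabulate f) ++ map Defs.y (tabulate f)
  tour-↭ [] f = ↭-refl
  tour-↭ (P ∷ Ps) f = ↭-trans (prep _ (++⁺ˡ (map old P) (prep _ (tour-↭ Ps (f ∘ suc)))))
    (↭-trans (solve 6 (λ y p x o xs ys → y ⊕ p ⊕ x ⊕ o ⊕ xs ⊕ ys ⊜ (p ⊕ o) ⊕ (x ⊕ xs) ⊕ y ⊕ ys) ↭-refl
        [ Defs.y (f zero) ] (map old P) [ Defs.x (f zero) ] (map old (concat Ps))
        (map Defs.x (tabulate (f ∘ suc))) (map Defs.y (tabulate (f ∘ suc))))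
      (++⁺ʳ _ (↭-reflexive (sym (map-++ old P (concat Ps))))))

  old? : ExtVertex k D → Maybe (Vertex D)
  old? (old u) = just u
  old? (Defs.x _) = nothing
  old? (Defs.y _) = nothing

  y? : ExtVertex k D → Maybe (Fin k)
  y? (old _) = nothing
  y? (Defs.x _) = nothing
  y? (Defs.y i) = just i

  private
    variable
      zs : List (ExtVertex k D)
      i j : Fin k

  -- Each path is opened by a visit to some `y`, so these visits bound the number of paths.
  Runs : List (ExtVertex k D) → Set
  Runs zs = ∃ λ Ps → All (IsPath Arc) Ps × concat Ps ≡ mapMaybe old? zs × length Ps ≤ length (mapMaybe y? zs)

  -- The path through `u` is still growing at its front, so it is returned apart from the finished
  -- ones and counted later, at the `y` that opens it.
  runs-old : ∀ {u} → Walk E (old u) (Defs.y i) zs → ∃₂ λ b ys → Walk Arc u b ys ×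
    ∃ λ Ps → All (IsPath Arc) Ps × ys ++ b ∷ concat Ps ≡ mapMaybe old? zs × length Ps ≤ length (mapMaybe y? zs)
  runs-x : Walk E (Defs.x j) (Defs.y i) zs → Runs zs
  runs-y : Walk E (Defs.y j) (Defs.y i) zs → Runs zs

  runs-old (old-old r ∷ w) with runs-old w
  ... | b , ys , w′ , Ps , ps , eq , le = b , _ ∷ ys , r ∷ w′ , Ps , ps , cong (_ ∷_) eq , le
  runs-old (old-x ∷ w) with runs-x w
  ... | Ps , ps , eq , le = _ , [] , [] , Ps , ps , cong (_ ∷_) eq , le

  runs-x (x-y ∷ w) = runs-y w

  runs-y [] = [] , [] , refl , z≤n
  runs-y (y-old ∷ w) with runs-old w
  ... | b , ys , w′ , Ps , ps , eq , le = (ys ∷ʳ b) ∷ Ps , (_ , b , ys , w′ , refl) ∷ ps ,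
        trans (++-assoc ys [ b ] _) eq , s≤s le

  olds-of-old : ∀ vs → mapMaybe old? (map old vs ++ zs) ≡ vs ++ mapMaybe old? zs
  olds-of-old [] = refl
  olds-of-old (v ∷ vs) = cong (v ∷_) (olds-of-old vs)

  olds-of-x : ∀ is → mapMaybe old? (map Defs.x is ++ zs) ≡ mapMaybe old? zs
  olds-of-x [] = refl
  olds-of-x (i ∷ is) = olds-of-x is

  olds-of-y : ∀ is → mapMaybe old? (map Defs.y is) ≡ []
  olds-of-y [] = refl
  olds-of-y (i ∷ is) = olds-of-y is

  ys-of-old : ∀ vs → mapMaybe y? (map old vs ++ zs) ≡ mapMaybe y? zs
  ys-of-old [] = refl
  ys-of-old (v ∷ vs) = ys-of-old vs

  ys-of-x : ∀ is → mapMaybe y? (map Defs.x is ++ zs) ≡ mapMaybe y? zs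
  ys-of-x [] = refl
  ys-of-x (i ∷ is) = ys-of-x is

  ys-of-y : ∀ is → mapMaybe y? (map Defs.y is) ≡ is
  ys-of-y [] = refl
  ys-of-y (i ∷ is) = cong (i ∷_) (ys-of-y is)

  olds-of-vertices : mapMaybe old? (Digraph.vertices (extension k D)) ≡ vertices
  olds-of-vertices = trans (olds-of-old vertices) (trans (cong (vertices ++_)
    (trans (olds-of-x (allFin k)) (olds-of-y (allFin k)))) (++-identityʳ vertices))

  ys-of-vertices : mapMaybe y? (Digraph.vertices (extension k D)) ≡ allFin k
  ys-of-vertices = trans (ys-of-old vertices) (trans (ys-of-x (allFin k)) (ys-of-y (allFin k)))

cover⇒hamiltonian : ∀ D {j} → Cover (Digraph.Arc D) j (Digraph.vertices D) → Hamiltonian (extension j D)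
cover⇒hamiltonian D (cycle (l , f , xs , r , w , p)) = cycle⇒hamiltonian (extension 0 D)
  (cycle-resp-↭ (↭-trans (map⁺ old p) (↭-reflexive (sym (++-identityʳ _))))
    (closedWalk⇒cycle (old-walk D 0 (r ∷ w))))
cover⇒hamiltonian D (paths {P = P} {Ps} ps p) = cycle⇒hamiltonian (extension k D)
  (cycle-resp-↭ (↭-trans (tour-↭ D k (P ∷ Ps) id) (++⁺ʳ _ (map⁺ old p)))
    (closedWalk⇒cycle (tour-walk D k ps id zero)))
  where
  k : ℕ
  k = suc (length Ps)

hamiltonian₀⇒cycle : ∀ D → Hamiltonian (extension 0 D) → Cycle (Digraph.Arc D) (Digraph.vertices D)
hamiltonian₀⇒cycle D ham with hamiltonian⇒cycle (extension 0 D) ham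
... | old l , old f , xs , old-old r , w , p = l , f , _ , r , un-old w ,
      ↭-trans (mapMaybe-↭ (old? D 0) p) (↭-reflexive (olds-of-vertices D 0))
  where
  un-old : ∀ {a b xs} → Walk (ExtArc 0 D) (old a) (old b) xs → Walk (Digraph.Arc D) a b (mapMaybe (old? D 0) xs)
  un-old [] = []
  un-old (old-old r ∷ w) = r ∷ un-old w

-- The cycle is read from a `y` onwards, so that its base point cuts no path in two.
hamiltonian⇒paths : ∀ D k → Hamiltonian (extension (suc k) D) →
  ∃ λ Ps → All (IsPath (Digraph.Arc D)) Ps × length Ps ≤ suc k × concat Ps ↭ Digraph.vertices D
hamiltonian⇒paths D k ham
  with cycle-from (Digraph.complete (extension (suc k) D) (Defs.y zero)) (hamiltonian⇒cycle (extension (suc k) D) ham)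
... | f , xs , r , w , p with runs-y D (suc k) (r ∷ w)
...   | Ps , ps , eq , le = Ps , ps ,
        ℕ.≤-trans le (ℕ.≤-reflexive (trans (↭-length (mapMaybe-↭ (y? D (suc k)) p))
          (trans (cong length (ys-of-vertices D (suc k))) (length-tabulate {n = suc k} id)))) ,
        ↭-trans (↭-reflexive eq) (↭-trans (mapMaybe-↭ (old? D (suc k)) p) (↭-reflexive (olds-of-vertices D (suc k))))

-- Strong subdigraphs made of a cycle and ears

module Skeleton (D : Digraph) {zs : List (Vertex D)} (C : Cycle (Digraph.Arc D) zs) where

  open Digraph D using (vertices; distinct; complete; Arc)

  -- The list `P` holds the inner vertices, so an ear has one arc more than it adds vertices. Its
  -- two ends may coincide.
  Ear : List (Vertex D) → Set
  Ear P = ∃₂ λ c c′ → c ∈ zs × c′ ∈ zs × Walk Arc c c′ (c ∷ P)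

  ear-arcs : ∀ {Ps} → All Ear Ps → List (Vertex D × Vertex D)
  ear-arcs [] = []
  ear-arcs ((_ , _ , _ , _ , w) ∷ ears) = arcs w ++ ear-arcs ears

  ear-arcs⊆ : ∀ {Ps} (ears : All Ear Ps) {a b} → (a , b) ∈ ear-arcs ears → Arc a b
  ear-arcs⊆ ((_ , _ , _ , _ , w) ∷ ears) e∈ with ∈-++⁻ (arcs w) e∈
  ... | inj₁ e∈w = arcs⊆ w e∈w
  ... | inj₂ e∈ears = ear-arcs⊆ ears e∈ears

  length-ear-arcs : ∀ {Ps} (ears : All Ear Ps) → length (ear-arcs ears) ≡ length (concat Ps) + length Ps
  length-ear-arcs [] = refl
  length-ear-arcs {P ∷ Ps} ((_ , _ , _ , _ , w) ∷ ears) = begin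
    length (arcs w ++ ear-arcs ears)                   ≡⟨ length-++ (arcs w) ⟩
    length (arcs w) + length (ear-arcs ears)           ≡⟨ cong₂ _+_ (length-arcs w) (length-ear-arcs ears) ⟩
    suc (length P) + (length (concat Ps) + length Ps)  ≡⟨ cong suc (ℕ.+-assoc (length P) _ _) ⟨
    suc (length P + length (concat Ps) + length Ps)    ≡⟨ ℕ.+-suc _ (length Ps) ⟨
    length P + length (concat Ps) + suc (length Ps)    ≡⟨ cong (_+ suc (length Ps)) (length-++ P) ⟨
    length (P ++ concat Ps) + suc (length Ps)          ∎
    where open ≡-Reasoning

  module _ {Ps} (ears : All Ear Ps) (spanning : zs ++ concat Ps ↭ vertices) where

    private
      l = proj₁ C

      walk : ∃ λ xs → Walk Arc l l xs × xs ↭ zs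
      walk = let _ , _ , _ , r , w , p = C in _ , r ∷ w , p

      arcList : List (Vertex D × Vertex D)
      arcList = arcs (proj₁ (proj₂ walk)) ++ ear-arcs ears

    subdigraph : SpanningSubdigraph D
    subdigraph = record
      { SubArc  = λ a b → (a , b) ∈ arcList
      ; subArc? = λ a b → DecMembership._∈?_ (Product.≡-dec (Digraph._≟_ D) (Digraph._≟_ D)) (a , b) arcList
      ; sub     = λ e∈ → either (∈-++⁻ (arcs (proj₁ (proj₂ walk))) e∈)
      }
      where
      either : ∀ {a b} → (a , b) ∈ arcs (proj₁ (proj₂ walk)) ⊎ (a , b) ∈ ear-arcs ears → Arc a b
      either (inj₁ e∈) = arcs⊆ (proj₁ (proj₂ walk)) e∈
      either (inj₂ e∈) = ear-arcs⊆ ears e∈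

    private
      S : Rel (Vertex D) 0ℓ
      S = SpanningSubdigraph.SubArc subdigraph

      around : Walk S l l (proj₁ walk)
      around = mapʷ (proj₁ (proj₂ walk)) ∈-++⁺ˡ

      on-cycle : ∀ {v} → v ∈ zs → Star S l v × Star S v l
      on-cycle v∈ = star-to around (∈-++⁺ˡ v∈′) , star-from around v∈′
        where v∈′ = ∈-resp-↭ (↭-sym (proj₂ (proj₂ walk))) v∈

      on-ear : ∀ {Ps v} (ears : All Ear Ps) → (∀ {e} → e ∈ ear-arcs ears → uncurry S e) →
        v ∈ concat Ps → Star S l v × Star S v l
      on-ear {P ∷ Ps} ((c , c′ , c∈ , c′∈ , w) ∷ ears) inS v∈ with ∈-++⁻ P v∈
      ... | inj₂ v∈Ps = on-ear ears (inS ∘ ∈-++⁺ʳ (arcs w)) v∈Ps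
      ... | inj₁ v∈P = proj₁ (on-cycle c∈) ◅◅ star-to w′ (there (∈-++⁺ˡ v∈P)) , star-from w′ (there v∈P) ◅◅ proj₂ (on-cycle c′∈)
        where w′ = mapʷ w (inS ∘ ∈-++⁺ˡ)

      hub : ∀ v → Star S l v × Star S v l
      hub v with ∈-++⁻ zs (∈-resp-↭ (↭-sym spanning) (complete v))
      ... | inj₁ v∈ = on-cycle v∈
      ... | inj₂ v∈ = on-ear ears (∈-++⁺ʳ (arcs (proj₁ (proj₂ walk)))) v∈

    strong : Strong (digraph subdigraph)
    strong u v = loop-erase (Digraph._≟_ D) (proj₂ (hub u) ◅◅ proj₁ (hub v))

    -- The cycle contributes as many arcs as vertices and each ear one more. Being arcs of a list,
    -- they number at most its length.
    size≤ : size (digraph subdigraph) ≤ order D + length Ps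
    size≤ = ℕ.≤-trans
      (unique-⊆⇒length≤ (Unique.filter⁺ dec (Unique.cartesianProduct⁺ distinct distinct))
        (λ e∈ → proj₂ (∈-filter⁻ dec {xs = cartesianProduct vertices vertices} e∈)))
      (ℕ.≤-reflexive (begin
        length arcList                                           ≡⟨ length-++ (arcs (proj₁ (proj₂ walk))) ⟩
        length (arcs (proj₁ (proj₂ walk))) + length (ear-arcs ears)
          ≡⟨ cong₂ _+_ (trans (length-arcs (proj₁ (proj₂ walk))) (↭-length (proj₂ (proj₂ walk)))) (length-ear-arcs ears) ⟩
        length zs + (length (concat Ps) + length Ps)             ≡⟨ ℕ.+-assoc (length zs) _ _ ⟨
        length zs + length (concat Ps) + length Ps               ≡⟨ cong (_+ length Ps) (length-++ zs) ⟨
        length (zs ++ concat Ps) + length Ps                     ≡⟨ cong (_+ length Ps) (↭-length spanning) ⟩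
        order D + length Ps                                      ∎))
      where
      open ≡-Reasoning
      dec = uncurry (SpanningSubdigraph.subArc? subdigraph)

-- The number ε

least : {P : Pred ℕ 0ℓ} → Decidable P → ∀ n → P n → ∃ λ k → P k × (∀ j → P j → k ≤ j)
least P? n Pn with P? 0
... | yes P0 = 0 , P0 , λ _ _ → z≤n
least P? zero Pn | no ¬P0 = ⊥-elim (¬P0 Pn)
least P? (suc n) Pn | no ¬P0 with least (P? ∘ suc) n Pn
... | k , Pk , min = suc k , Pk , λ { zero P0 → ⊥-elim (¬P0 P0) ; (suc j) Pj → s≤s (min j Pj) }

words : {A : Set} → List A → ℕ → List (List A)
words vs zero = [ [] ]
words vs (suc n) = cartesianProductWith _∷_ vs (words vs n)

∈-words : {A : Set} {vs : List A} → (∀ v → v ∈ vs) → ∀ ws → ws ∈ words vs (length ws)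
∈-words all [] = here refl
∈-words all (w ∷ ws) = ∈-cartesianProductWith⁺ _∷_ (all w) (∈-words all ws)

module _ (D : Digraph) where

  open Digraph D using (vertices; distinct; complete; Arc; arc?)

  HamiltonianList : List (Vertex D) → Set
  HamiltonianList [] = ⊥
  HamiltonianList (v ∷ vs) = IsCycle D v vs × (∀ u → u ∈ v ∷ vs)

  hamiltonianList? : Decidable HamiltonianList
  hamiltonianList? [] = no λ ()
  hamiltonianList? (v ∷ vs) =
    (unique? (Digraph._≟_ D) (v ∷ vs) ×-dec Linked.linked? arc? (v ∷ (vs ∷ʳ v))) ×-dec
    map′ (λ all u → All.lookup all (complete u)) (λ all → All.tabulate (λ _ → all _))
      (All.all? (λ u → DecMembership._∈?_ (Digraph._≟_ D) u (v ∷ vs)) vertices)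

  -- A Hamiltonian cycle lists each vertex once, so it suffices to search the lists of length
  -- `order D`. Decidability is needed to find the least k.
  hamiltonian? : Dec (Hamiltonian D)
  hamiltonian? = map′ to from (Any.any? hamiltonianList? (words vertices (order D)))
    where
    to : Any HamiltonianList (words vertices (order D)) → Hamiltonian D
    to any with find any
    ... | v ∷ vs , _ , ham = v , vs , ham

    from : Hamiltonian D → Any HamiltonianList (words vertices (order D))
    from (v , vs , ham@((u , _) , all)) = lose
      (subst (λ n → v ∷ vs ∈ words vertices n)
        (↭-length (unique-⊆⊇⇒↭ u distinct (λ _ → complete _) (λ _ → all _)))
        (∈-words complete (v ∷ vs)))
      ham

-- Compositions

concatMap-↭ : {A B : Set} (f : A → List B) {xs ys : List A} → xs ↭ ys → concatMap f xs ↭ concatMap f ys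
concatMap-↭ f _↭_.refl = ↭-refl
concatMap-↭ f (prep x p) = ++⁺ˡ (f x) (concatMap-↭ f p)
concatMap-↭ f (swap x y p) = ↭-trans (shifts (f x) (f y)) (++⁺ˡ (f y) (++⁺ˡ (f x) (concatMap-↭ f p)))
concatMap-↭ f (_↭_.trans p q) = ↭-trans (concatMap-↭ f p) (concatMap-↭ f q)

module Composition (T : Digraph) (H : Vertex T → Digraph) (nonempty : ∀ i → Vertex (H i))
  (semicomplete : Semicomplete T) (connected : ∀ u v → Star (CompArc T H) u v) where

  private
    module T = Digraph T
    Q = composition T H

  -- A run of a path of Q inside H i: a stretch that uses inner arcs only.
  RunFrom : (i : Vertex T) → Vertex (H i) → Set
  RunFrom i f = ∃₂ λ l xs → Walk (Digraph.Arc (H i)) f l xs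

  Run : Set
  Run = Σ (Vertex T) λ i → Σ (Vertex (H i)) (RunFrom i)

  part : Run → Vertex T
  part = proj₁

  first last : Run → CompVertex T H
  first (i , f , _) = i , f
  last (i , _ , l , _) = i , l

  front : Run → List (CompVertex T H)
  front (i , _ , _ , xs , _) = map (i ,_) xs

  verts : Run → List (CompVertex T H)
  verts v = front v ∷ʳ last v

  open Exchange T.arc? T.loopless T._≟_ semicomplete part

  run-walk : ∀ v → Walk (CompArc T H) (first v) (last v) (front v)
  run-walk (i , f , l , xs , w) = go w
    where
    go : ∀ {a b xs} → Walk (Digraph.Arc (H i)) a b xs → Walk (CompArc T H) (i , a) (i , b) (map (i ,_) xs)
    go [] = []
    go (r ∷ w) = inner r ∷ go w

  first∈verts : ∀ v → first v ∈ verts v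
  first∈verts v with run-walk v
  ... | w with front v
  first∈verts v | [] | [] = here refl
  first∈verts v | _ ∷ _ | _ ∷ _ = here refl

  last∈verts : ∀ v → last v ∈ verts v
  last∈verts v = ∈-++⁺ʳ (front v) (here refl)

  -- The first run is returned apart, because an inner arc extends it at its front. An outer arc
  -- starts a new run and links the two parts.
  runs : ∀ {i f b zs} → Walk (CompArc T H) (i , f) b zs →
    Σ (RunFrom i f) λ r → ∃ λ rs → Linked R ((i , f , r) ∷ rs) × concatMap verts ((i , f , r) ∷ rs) ≡ zs ∷ʳ b
  runs [] = (_ , [] , []) , [] , [-] , refl
  runs (inner a ∷ w) with runs w
  ... | (l , xs , w′) , rs , links , eq = (l , _ ∷ xs , a ∷ w′) , rs , relink links , cong (_ ∷_) eq
    where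
    relink : ∀ {i f g r s rs} → Linked R ((i , f , r) ∷ rs) → Linked R ((i , g , s) ∷ rs)
    relink [-] = [-]
    relink (r ∷ rs) = r ∷ rs
  runs (outer a ∷ w) with runs w
  ... | r , rs , links , eq = (_ , [] , []) , (_ , _ , r) ∷ rs , a ∷ links , cong (_ ∷_) eq

  runs-of-paths : ∀ {Ps} → All (IsPath (CompArc T H)) Ps →
    ∃ λ Xs → All (Linked R) Xs × length Xs ≡ length Ps × concatMap verts (concat Xs) ≡ concat Ps
  runs-of-paths [] = [] , [] , refl , refl
  runs-of-paths ((a , b , ys , w , refl) ∷ ps) with runs w | runs-of-paths ps
  ... | r , rs , links , eq | Xs , linked , len , eq′ =
    ((_ , _ , r) ∷ rs) ∷ Xs , links ∷ linked , cong suc len ,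
    trans (concatMap-++ verts ((_ , _ , r) ∷ rs) (concat Xs)) (cong₂ _++_ eq eq′)

  -- An arc of `T` joins all vertices of one part to all of the other, in particular the end of one
  -- run to the start of the next.
  expand : ∀ {a b vs} → Walk R a b vs → Walk (CompArc T H) (first a) (first b) (concatMap verts vs)
  expand [] = []
  expand (_∷_ {a} r w) = subst (Walk _ _ _) (sym (++-assoc (front a) [ last a ] _))
    (run-walk a ++ʷ (outer r ∷ expand w))

  expand-cycle : ∀ {vs} → Cycle R vs → Cycle (CompArc T H) (concatMap verts vs)
  expand-cycle (l , f , xs , r , w , p) = last l , first f , _ , outer r , expand w ++ʷ run-walk l ,
    ↭-trans (solve 3 (λ l xs fr → l ⊕ xs ⊕ fr ⊜ (fr ⊕ l) ⊕ xs) ↭-refl [ last l ] (concatMap verts xs) (front l))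
      (concatMap-↭ verts p)

  connected-parts : ∀ i j → Star T.Arc i j
  connected-parts i j = project (connected (i , nonempty i) (j , nonempty j))
    where
    project : ∀ {u v} → Star (CompArc T H) u v → Star T.Arc (proj₁ u) (proj₁ v)
    project ε = ε
    project (inner _ ◅ w) = project w
    project (outer a ◅ w) = a ◅ project w

  module _ {vs} (C : Cycle R vs) (hits : ∀ q → Any (λ c → part c ≡ q) vs) where

    open AroundCycle C using (hit⇒hasIn; hit⇒hasOut)
    open Skeleton Q (expand-cycle C) using (Ear)

    walk-out : ∀ {x xs} → Linked R (x ∷ xs) → ∃ λ c → c ∈ vs × Walk R x c (x ∷ xs)
    walk-out {x} [-] with find (hit⇒hasOut (hits (part x)))
    ... | c , c∈ , r = c , c∈ , r ∷ []
    walk-out (r ∷ rs) with walk-out rs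
    ... | c , c∈ , w = c , c∈ , r ∷ w

    chain⇒ear : ∀ {x xs} → Linked R (x ∷ xs) → Ear (concatMap verts (x ∷ xs))
    chain⇒ear {x} rs with find (hit⇒hasIn (hits (part x))) | walk-out rs
    ... | c , c∈ , r | c′ , c′∈ , w = last c , first c′ ,
      ∈-concatMap⁺ verts (lose c∈ (last∈verts c)) , ∈-concatMap⁺ verts (lose c′∈ (first∈verts c′)) , outer r ∷ expand w

    -- Empty lists, such as those whose items have all moved to the cycle, are dropped, hence the
    -- inequality.
    chains⇒ears : ∀ {Ps} → All (AllPairs R) Ps →
      ∃ λ Es → All Ear Es × length Es ≤ length Ps × concat Es ≡ concatMap verts (concat Ps)
    chains⇒ears [] = [] , [] , z≤n , refl
    chains⇒ears {[] ∷ Ps} (_ ∷ aps) with chains⇒ears aps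
    ... | Es , ears , le , eq = Es , ears , ℕ.m≤n⇒m≤1+n le , eq
    chains⇒ears {(x ∷ xs) ∷ Ps} (ap ∷ aps) with chains⇒ears aps
    ... | Es , ears , le , eq = concatMap verts (x ∷ xs) ∷ Es , chain⇒ear (Linked.AllPairs⇒Linked ap) ∷ ears , s≤s le ,
          trans (cong (concatMap verts (x ∷ xs) ++_) eq) (sym (concatMap-++ verts (x ∷ xs) (concat Ps)))

  SmallStrong : ℕ → Set₁
  SmallStrong k = Σ (SpanningSubdigraph Q) λ S → Strong (digraph S) × size (digraph S) ≤ order Q + k

  small-strong : ∀ {i j : Vertex T} → i ≢ j → ∀ k → Hamiltonian (extension k Q) → SmallStrong k
  -- For k = 0 the Hamiltonian cycle of `Q` itself is taken, without ears.
  small-strong _ zero ham = subdigraph [] p , strong [] p , size≤ [] p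
    where
    open Skeleton Q (hamiltonian₀⇒cycle Q ham)
    p = ↭-reflexive (++-identityʳ _)
  small-strong i≢j (suc k) ham with hamiltonian⇒paths Q k ham
  ... | Ps , ps , len , p with runs-of-paths ps | exists-cycle T._≟_ connected-parts i≢j
  ...   | Xs , linked , eq , eq′ | qs , cyc , uniq
    with spanning-cycle T.vertices T.complete connected-parts (concat Xs) rep cyc uniq Xs linked ↭-refl
    where
    rep : ∀ q → ∃ λ v → v ∈ concat Xs × part v ≡ q
    -- No part is empty, so each one has a vertex, and this vertex lies in some run.
    rep q with find (∈-concatMap⁻ verts (∈-resp-↭ (↭-trans (↭-sym p) (↭-reflexive (sym eq′)))
                  (Digraph.complete Q (q , nonempty q))))
    ... | v , v∈ , u∈ = v , v∈ , part-of v u∈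
      where
      part-of : ∀ v {u} → u ∈ verts v → part v ≡ proj₁ u
      part-of v u∈ with ∈-++⁻ (front v) u∈
      ... | inj₂ (here refl) = refl
      ... | inj₁ u∈front with ∈-map⁻ (part v ,_) u∈front
      ...   | _ , _ , refl = refl
  ...     | vs , Cs , C , chains , le , q , hits with chains⇒ears C hits chains
  ...       | Es , ears , le′ , eq″ = subdigraph ears span , strong ears span ,
              ℕ.≤-trans (size≤ ears span) (ℕ.+-monoʳ-≤ (order Q)
                (ℕ.≤-trans le′ (ℕ.≤-trans le (ℕ.≤-trans (ℕ.≤-reflexive eq) len))))
    where
    open Skeleton Q (expand-cycle C)
    span : concatMap verts vs ++ concat Es ↭ Digraph.vertices Q
    span = ↭-trans (↭-reflexive (trans (cong (concatMap verts vs ++_) eq″) (sym (concatMap-++ verts vs (concat Cs)))))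
             (↭-trans (concatMap-↭ verts q) (↭-trans (↭-reflexive eq′) p))

-- Sizes of strong spanning subdigraphs of the composition

two-vertices : ∀ D → 2 ≤ order D → ∃₂ λ (u v : Vertex D) → u ≢ v
two-vertices D le with Digraph.vertices D | Digraph.distinct D
two-vertices D (s≤s ()) | u ∷ [] | _
... | u ∷ v ∷ _ | (u≢v ∷ _) ∷ _ = u , v , u≢v

a-vertex : ∀ D → 1 ≤ order D → Vertex D
a-vertex D le with Digraph.vertices D
... | v ∷ _ = v

theorem5p8 : (T : Digraph) (H : Vertex T → Digraph) →
    2 ≤ order T →
    (∀ i → 1 ≤ order (H i)) →
    Semicomplete T →
    Strong (composition T H) →
    ∃ λ (k : ℕ) → IsEpsilon (composition T H) k ×
    (∃ λ (S : SpanningSubdigraph (composition T H)) → IsSmallestStrongSpanning (composition T H) S) ×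
    (∀ (S : SpanningSubdigraph (composition T H)) → IsSmallestStrongSpanning (composition T H) S →
    size (digraph S) ≡ order (composition T H) + k)
theorem5p8 T H two≤ one≤ semicomplete strong = k , (ham , minimal) , (S , S-strong , S-smallest) , exact
  where
  Q : Digraph
  Q = composition T H

  nonempty : ∀ i → Vertex (H i)
  nonempty i = a-vertex (H i) (one≤ i)

  two : ∃₂ λ (i j : Vertex T) → i ≢ j
  two = two-vertices T two≤

  two-in-Q : (proj₁ two , nonempty (proj₁ two)) ≢ (proj₁ (proj₂ two) , nonempty (proj₁ (proj₂ two)))
  two-in-Q = proj₂ (proj₂ two) ∘ cong proj₁

  lower : (S : SpanningSubdigraph Q) → Strong (digraph S) →
    ∃ λ j → order Q + j ≤ size (digraph S) × Hamiltonian (extension j Q)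
  lower S str with Ears.cover-by-ears (digraph S) (λ u v → proj₁ (str u v)) two-in-Q
  ... | j , le , cov = j , le , cover⇒hamiltonian Q (cover-map (SpanningSubdigraph.sub S) cov)

  whole : SpanningSubdigraph Q
  whole = record { SubArc = Digraph.Arc Q ; subArc? = Digraph.arc? Q ; sub = id }

  ε-exists : ∃ λ k → Hamiltonian (extension k Q) × (∀ j → Hamiltonian (extension j Q) → k ≤ j)
  -- The ears of `Q` itself provide some `j` for which `H_j` is Hamiltonian, and this starts the
  -- search for the least one.
  ε-exists = let j , _ , ham = lower whole strong in least (λ j → hamiltonian? (extension j Q)) j ham

  k = proj₁ ε-exists
  ham = proj₁ (proj₂ ε-exists)
  minimal = proj₂ (proj₂ ε-exists)

  open Composition T H nonempty semicomplete (λ u v → proj₁ (strong u v)) using (SmallStrong; small-strong)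

  small : SmallStrong k
  small = small-strong (proj₂ (proj₂ two)) k ham

  S = proj₁ small
  S-strong = proj₁ (proj₂ small)

  n+k≤ : (S : SpanningSubdigraph Q) → Strong (digraph S) → order Q + k ≤ size (digraph S)
  n+k≤ S str = let j , le , ham-j = lower S str in
    ℕ.≤-trans (ℕ.+-monoʳ-≤ (order Q) (minimal j ham-j)) le

  S-smallest : (S′ : SpanningSubdigraph Q) → Strong (digraph S′) → size (digraph S) ≤ size (digraph S′)
  S-smallest S′ str = ℕ.≤-trans (proj₂ (proj₂ small)) (n+k≤ S′ str)

  exact : (S′ : SpanningSubdigraph Q) → IsSmallestStrongSpanning Q S′ → size (digraph S′) ≡ order Q + k
  exact S′ (str , smallest) =
    ℕ.≤-antisym (ℕ.≤-trans (smallest S S-strong) (proj₂ (proj₂ small))) (n+k≤ S′ str)
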